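{- Let $\mathbb{F}$ be an infinite field of characteristic different from $2$, let $k\ge 1$, and let $G$ be a $k$-path on $n$ vertices. Then $mr^{ - }(\mathbb{F},G)=n-k$ if $n-k$ is even, and $mr^{ - }(\mathbb{F},G)=n-k+1$ if $n-k$ is odd.
   Context: All graphs are finite and simple. For a field $\mathbb{F}$ and a graph $G$ on vertices $v_1,\dots,v_n$, $S^{ - }(\mathbb{F},G)$ is the set of skew-symmetric matrices $A\in\mathbb{F}^{n\times n}$ such that for $i\neq j$, $a_{ij}\neq0$ iff $v_iv_j$ is an edge; $mr^{ - }(\mathbb{F},G)=\min\{\operatorname{rank}A: A\in S^{ - }(\mathbb{F},G)\}$. $k$-trees are defined recursively: $K_{k+1}$ is a $k$-tree; a $k$-tree on $n+1$ vertices ($n\ge k+1$) is obtained from a $k$-tree $H$ on $n$ vertices by adding a vertex adjacent to all vertices of a $k$-clique of $H$. A $k$-path is a $k$-tree that is either $K_{k+1}$ or has exactly two vertices of degree $k$. -}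

module Defs where

open import Level using (Level; _⊔_)
open import Algebra.Bundles using (CommutativeRing)
open import Data.Nat using (ℕ; zero; suc; _≤_; _≡ᵇ_)
import Data.Nat as ℕ
open import Data.Fin using (Fin; inject₁; fromℕ)
import Data.Fin
open import Data.Fin.Permutation using (Permutation′; _⟨$⟩ʳ_)
open import Data.Bool using (Bool; true; false; if_then_else_)
open import Data.List using (List; sum; map; filter; length; allFin)
open import Data.Product using (Σ; ∃; _×_; _,_)
open import Data.Sum using (_⊎_)
open import Relation.Nullary using (¬_)
open import Relation.Binary.PropositionalEquality using (_≡_; _≢_)
open import Data.Nat.Properties using (_≟_)
open import Function.Definitions using (Injective)

record Field (c ℓ : Level) : Set (Level.suc (c ⊔ ℓ)) where
  field
    commutativeRing : CommutativeRing c ℓ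
  open CommutativeRing commutativeRing public
  field
    1≉0     : ¬ (1# ≈ 0#)
    inverse : ∀ x → ¬ (x ≈ 0#) → ∃ λ y → x * y ≈ 1#

module _ {c ℓ : Level} (F : Field c ℓ) where
  open Field F

  Infinite : Set (c ⊔ ℓ)
  Infinite = Σ (ℕ → Carrier) λ f → ∀ m n → f m ≈ f n → m ≡ n

  CharNot2 : Set ℓ
  CharNot2 = ¬ (1# + 1# ≈ 0#)

  Matrix : ℕ → Set c
  Matrix n = Fin n → Fin n → Carrier

  ∑ : (m : ℕ) → (Fin m → Carrier) → Carrier
  ∑ zero    f = 0#
  ∑ (suc m) f = f Data.Fin.zero + ∑ m (λ i → f (Data.Fin.suc i))

  -- the columns of A indexed by  cols : Fin m → Fin n  are linearly
  -- independent (in particular cols must be injective)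
  IndependentCols : {n m : ℕ} → Matrix n → (Fin m → Fin n) → Set (c ⊔ ℓ)
  IndependentCols {n} {m} A cols =
    ∀ (coef : Fin m → Carrier) →
      (∀ i → ∑ m (λ j → A i (cols j) * coef j) ≈ 0#) →
      ∀ j → coef j ≈ 0#

  HasRank : {n : ℕ} → Matrix n → ℕ → Set (c ⊔ ℓ)
  HasRank {n} A r =
    (Σ (Fin r → Fin n) λ cols → IndependentCols A cols) ×
    (∀ (s : ℕ) (cols : Fin s → Fin n) → IndependentCols A cols → s ≤ r)

record Graph (n : ℕ) : Set where
  field
    adj   : Fin n → Fin n → Bool
    sym   : ∀ i j → adj i j ≡ adj j i
    irrefl : ∀ i → adj i i ≡ false
open Graph public

module _ {c ℓ : Level} (F : Field c ℓ) where
  open Field F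

  InSminus : {n : ℕ} → Graph n → Matrix F n → Set ℓ
  InSminus {n} G A =
    (∀ i j → A j i ≈ - A i j) ×
    (∀ i j → i ≢ j → (¬ (A i j ≈ 0#) → adj G i j ≡ true)
                   × (adj G i j ≡ true → ¬ (A i j ≈ 0#)))

  MinSkewRank : {n : ℕ} → Graph n → ℕ → Set (c ⊔ ℓ)
  MinSkewRank {n} G r =
    (Σ (Matrix F n) λ A → InSminus G A × HasRank F A r) ×
    (∀ (A : Matrix F n) (s : ℕ) → InSminus G A → HasRank F A s → r ≤ s)

count : {n : ℕ} → (Fin n → Bool) → ℕ
count {zero}  p = 0
count {suc n} p = (if p Data.Fin.zero then 1 else 0) ℕ.+ count (λ i → p (Data.Fin.suc i))

degree : {n : ℕ} → Graph n → Fin n → ℕ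
degree G i = count (adj G i)

dropLast : {n : ℕ} → Graph (suc n) → Graph n
dropLast G = record
  { adj    = λ i j → adj G (inject₁ i) (inject₁ j)
  ; sym    = λ i j → sym G (inject₁ i) (inject₁ j)
  ; irrefl = λ i → irrefl G (inject₁ i) }

IsComplete : {n : ℕ} → Graph n → Set
IsComplete {n} G = ∀ (i j : Fin n) → i ≢ j → adj G i j ≡ true

data KTree (k : ℕ) : (n : ℕ) → Graph n → Set where
  base : (G : Graph (suc k)) → IsComplete G → KTree k (suc k) G
  step : {n : ℕ} (G : Graph (suc n)) →
         KTree k n (dropLast G) →
         count (λ j → adj G (fromℕ n) (inject₁ j)) ≡ k →
         (∀ i j → adj G (fromℕ n) (inject₁ i) ≡ true →
                  adj G (fromℕ n) (inject₁ j) ≡ true →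
                  i ≢ j → adj G (inject₁ i) (inject₁ j) ≡ true) →
         KTree k (suc n) G
  iso  : {n : ℕ} (G H : Graph n) (σ : Permutation′ n) →
         (∀ i j → adj H (σ ⟨$⟩ʳ i) (σ ⟨$⟩ʳ j) ≡ adj G i j) →
         KTree k n G → KTree k n H

KPath : (k n : ℕ) → Graph n → Set
KPath k n G =
  KTree k n G ×
  ((n ≡ suc k × IsComplete G) ⊎ count (λ i → degree G i ≡ᵇ k) ≡ 2)

{-# OPTIONS --safe #-}

-- A k-path on n = m + 1 + k vertices is the intersection graph of intervals
-- [L i, R i] ⊆ [0, m]: its maximal cliques Q 0, …, Q m form a walk in which each step
-- replaces one vertex, and the vertex entering Q (t + 1) is never the one leaving it.
-- Giving an entering vertex the colour of the vertex it replaces yields a proper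
-- colouring.
--
-- Lower bound: rows indexed by the vertices with R = t and columns indexed by vertices
-- with L = t form a triangular submatrix of order m + 1 = n - k, and a skew-symmetric
-- matrix has even rank.
--
-- Upper bound: group the cliques in pairs into ⌊m/2⌋ + 1 cells.  With f an injective
-- sequence in the field, cell l contributes the rank 2 matrix with entries
-- (f (colour j) - f (colour i)) (f (l + 1) - f l) for i, j in the cell.  The cells
-- containing both i and j are consecutive, so the second factors telescope to a
-- difference of distinct values of f, while nonadjacent vertices of a cell have the
-- same colour: the sum vanishes exactly off the edges.  No entry has to be chosen
-- generically, which matters because equality in the field is not decidable.
module Submission where

open import Defs hiding (sym)
open import Level using (Level; _⊔_)
open import Data.Nat using (ℕ; zero; suc; _∸_; _≤_; _<_; z≤n; s≤s; ⌊_/2⌋)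
import Data.Nat as ℕ
import Data.Nat.Properties as ℕ
open import Data.Nat.DivMod using (_%_; m*n%n≡0)
open import Data.Fin using (Fin; zero; suc; inject₁; fromℕ; toℕ; punchIn)
import Data.Fin as Fin
import Data.Fin.Properties as Fin
open import Data.Fin.Permutation using (Permutation′; _⟨$⟩ʳ_; _⟨$⟩ˡ_; inverseʳ; inverseˡ)
open import Data.Fin.Relation.Unary.Top using (view; ‵fromℕ; ‵inj₁)
open import Data.Bool using (Bool; true; false; if_then_else_)
open import Data.Bool.Properties using (¬-not) renaming (_≟_ to _≟ᵇ_)
open import Data.List using (List; []; _∷_; allFin)
open import Data.List.Membership.Propositional using (_∈_)
open import Data.List.Membership.Propositional.Properties using (∈-allFin)
open import Data.List.Relation.Unary.Any using (here; there)
open import Data.Maybe using (Maybe; just; nothing)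
open import Data.Product using (Σ; ∃; ∃₂; _×_; _,_; proj₁; proj₂)
open import Data.Product.Properties using (≡-dec)
open import Data.Sum using (_⊎_; inj₁; inj₂)
open import Data.Empty using (⊥; ⊥-elim)
open import Effect.Monad using (RawMonad)
open import Function using (_∘_; case_of_)
open import Relation.Nullary using (¬_; Dec; yes; no; does)
open import Relation.Nullary.Negation using (contradiction; ¬¬-Monad)
open import Relation.Nullary.Decidable using (¬¬-excluded-middle; dec-true; dec-false; _×-dec_)
open import Relation.Binary.PropositionalEquality as ≡ using (_≡_; _≢_)
import Relation.Binary.Reasoning.Setoid
open import Algebra.Bundles using (CommutativeRing; RawRing)
import Algebra.Properties.CommutativeSemigroup
import Algebra.Properties.Ring
import Algebra.Properties.Semiring.Mult
import Algebra.Solver.Ring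
import Algebra.Solver.Ring.AlmostCommutativeRing as ACR

-- A ring solver whose coefficients are integers, represented as reduced formal
-- differences of natural numbers: equality in the ring itself is not decidable.
module RingSolver {c ℓ : Level} (R : CommutativeRing c ℓ) where
  open CommutativeRing R hiding (zero)
  open Algebra.Properties.Ring ring
  open Algebra.Properties.CommutativeSemigroup +-commutativeSemigroup using (interchange)
  open Algebra.Properties.Semiring.Mult semiring using (×-homo-+; ×1-homo-*) renaming (_×_ to _×ᵣ_)
  open Relation.Binary.Reasoning.Setoid setoid

  private
    Difference : Set
    Difference = ℕ × ℕ

    -- Cancelling until one component is zero gives each integer a single representative, so that
    -- `coefficients-≟` may compare with `_≡_`.
    reduce : ℕ → ℕ → Difference
    reduce (suc a) (suc b) = reduce a b
    reduce a       b       = a , b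

    differences : RawRing _ _
    differences = record
      { Carrier = Difference
      ; _≈_ = _≡_
      ; _+_ = λ (a , b) (c , d) → reduce (a ℕ.+ c) (b ℕ.+ d)
      ; _*_ = λ (a , b) (c , d) → reduce (a ℕ.* c ℕ.+ b ℕ.* d) (a ℕ.* d ℕ.+ b ℕ.* c)
      ; -_ = λ (a , b) → b , a
      ; 0# = 0 , 0
      ; 1# = 1 , 0
      }

    ι : ℕ → Carrier
    ι n = n ×ᵣ 1#

    -- The separate case for a zero second component makes `(0 , 0)` evaluate to `0#` by definition,
    -- which is what `#0` relies on.
    value : Difference → Carrier
    value (a , zero)  = ι a
    value (a , suc b) = ι a - ι (suc b)

    value-difference : ∀ a b → value (a , b) ≈ ι a - ι b
    value-difference a zero    = sym (trans (+-congˡ -0#≈0#) (+-identityʳ _))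
    value-difference a (suc b) = refl

    -‿distrib-+ : ∀ x y → - (x + y) ≈ - x + - y
    -‿distrib-+ x y = sym (-‿+-comm x y)

    value-reduce : ∀ a b → value (reduce a b) ≈ ι a - ι b
    value-reduce (suc a) (suc b) = begin
      value (reduce a b)           ≈⟨ value-reduce a b ⟩
      ι a - ι b                    ≈⟨ +-identityˡ _ ⟨
      0# + (ι a - ι b)             ≈⟨ +-congʳ (-‿inverseʳ 1#) ⟨
      (1# - 1#) + (ι a - ι b)      ≈⟨ interchange _ _ _ _ ⟩
      ι (suc a) + (- 1# + - ι b)   ≈⟨ +-congˡ (-‿+-comm _ _) ⟩
      ι (suc a) - ι (suc b)        ∎
    value-reduce zero    b       = value-difference zero b
    value-reduce (suc a) zero    = value-difference (suc a) zero

    +-homo : ∀ x y → value (RawRing._+_ differences x y) ≈ value x + value y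
    +-homo (a , b) (c , d) = begin
      value (reduce (a ℕ.+ c) (b ℕ.+ d))  ≈⟨ value-reduce (a ℕ.+ c) (b ℕ.+ d) ⟩
      ι (a ℕ.+ c) - ι (b ℕ.+ d)           ≈⟨ +-cong (×-homo-+ 1# a c) (-‿cong (×-homo-+ 1# b d)) ⟩
      (ι a + ι c) - (ι b + ι d)           ≈⟨ +-congˡ (-‿distrib-+ _ _) ⟩
      (ι a + ι c) + (- ι b + - ι d)       ≈⟨ interchange _ _ _ _ ⟩
      (ι a - ι b) + (ι c - ι d)           ≈⟨ +-cong (value-difference a b) (value-difference c d) ⟨
      value (a , b) + value (c , d)       ∎

    *-homo : ∀ x y → value (RawRing._*_ differences x y) ≈ value x * value y
    *-homo (a , b) (c , d) = begin
      value (reduce (a ℕ.* c ℕ.+ b ℕ.* d) (a ℕ.* d ℕ.+ b ℕ.* c))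
        ≈⟨ value-reduce (a ℕ.* c ℕ.+ b ℕ.* d) (a ℕ.* d ℕ.+ b ℕ.* c) ⟩
      ι (a ℕ.* c ℕ.+ b ℕ.* d) - ι (a ℕ.* d ℕ.+ b ℕ.* c)
        ≈⟨ +-cong (sum-of-products a c b d) (-‿cong (sum-of-products a d b c)) ⟩
      (ι a * ι c + ι b * ι d) - (ι a * ι d + ι b * ι c)
        ≈⟨ +-congˡ (-‿distrib-+ _ _) ⟩
      (ι a * ι c + ι b * ι d) + (- (ι a * ι d) + - (ι b * ι c))
        ≈⟨ interchange _ _ _ _ ⟩
      (ι a * ι c - ι a * ι d) + (ι b * ι d - ι b * ι c)
        ≈⟨ +-cong (x[y-z]≈xy-xz _ _ _) (x[y-z]≈xy-xz _ _ _) ⟨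
      ι a * (ι c - ι d) + ι b * (ι d - ι c)
        ≈⟨ +-congˡ (trans (sym (-‿distribˡ-* _ _)) (trans (-‿distribʳ-* _ _) (*-congˡ (⁻¹-anti-homo‿- _ _)))) ⟨
      ι a * (ι c - ι d) + - ι b * (ι c - ι d)
        ≈⟨ distribʳ _ _ _ ⟨
      (ι a - ι b) * (ι c - ι d)
        ≈⟨ *-cong (value-difference a b) (value-difference c d) ⟨
      value (a , b) * value (c , d)  ∎
      where
      sum-of-products : ∀ p q r s → ι (p ℕ.* q ℕ.+ r ℕ.* s) ≈ ι p * ι q + ι r * ι s
      sum-of-products p q r s =
        trans (×-homo-+ 1# (p ℕ.* q) (r ℕ.* s)) (+-cong (×1-homo-* p q) (×1-homo-* r s))

    -‿homo : ∀ x → value (RawRing.-_ differences x) ≈ - value x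
    -‿homo (a , b) = begin
      value (b , a)    ≈⟨ value-difference b a ⟩
      ι b - ι a        ≈⟨ ⁻¹-anti-homo‿- _ _ ⟨
      - (ι a - ι b)    ≈⟨ -‿cong (value-difference a b) ⟨
      - value (a , b)  ∎

    homomorphism : differences ACR.-Raw-AlmostCommutative⟶ ACR.fromCommutativeRing R
    homomorphism = record
      { ⟦_⟧ = value
      ; +-homo = +-homo
      ; *-homo = *-homo
      ; -‿homo = -‿homo
      ; 0-homo = refl
      ; 1-homo = +-identityʳ 1#
      }

    coefficients-≟ : ∀ x y → Maybe (value x ≈ value y)
    coefficients-≟ x y with ≡-dec ℕ._≟_ ℕ._≟_ x y
    ... | yes ≡.refl = just refl
    ... | no _       = nothing

  open Algebra.Solver.Ring differences (ACR.fromCommutativeRing R) homomorphism coefficients-≟ public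
    using (Polynomial; solve; _:=_; _:+_; _:*_; _:-_; :-_; con)

  #0 : ∀ {n} → Polynomial n
  #0 = con (0 , 0)


-- Linear algebra over a field without decidable equality.

module Matrices {c ℓ : Level} (F : Field c ℓ) where
  open Field F hiding (zero)
  open RingSolver commutativeRing
  open Relation.Binary.Reasoning.Setoid setoid

  ¬0-* : ∀ {x y} → ¬ x ≈ 0# → ¬ y ≈ 0# → ¬ x * y ≈ 0#
  ¬0-* {x} {y} x≉0 y≉0 xy≈0 = y≉0 (begin
    y                ≈⟨ *-identityˡ y ⟨
    1# * y           ≈⟨ *-congʳ (proj₂ (inverse x x≉0)) ⟨
    x * x⁻¹ * y      ≈⟨ solve 3 (λ x z y → x :* z :* y := z :* (x :* y)) refl x x⁻¹ y ⟩
    x⁻¹ * (x * y)    ≈⟨ *-congˡ xy≈0 ⟩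
    x⁻¹ * 0#         ≈⟨ zeroʳ _ ⟩
    0#               ∎)
    where x⁻¹ = proj₁ (inverse x x≉0)

  cancel-invertible : ∀ {a b x} → a * b ≈ 1# → a * x ≈ 0# → x ≈ 0#
  cancel-invertible {a} {b} {x} ab≈1 ax≈0 = begin
    x            ≈⟨ *-identityˡ x ⟨
    1# * x       ≈⟨ *-congʳ ab≈1 ⟨
    a * b * x    ≈⟨ solve 3 (λ a b x → a :* b :* x := b :* (a :* x)) refl a b x ⟩
    b * (a * x)  ≈⟨ *-congˡ ax≈0 ⟩
    b * 0#       ≈⟨ zeroʳ b ⟩
    0#           ∎

  ∑-cong : ∀ {m} {f g : Fin m → Carrier} → (∀ i → f i ≈ g i) → ∑ F m f ≈ ∑ F m g
  ∑-cong {zero}  f≈g = refl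
  ∑-cong {suc m} f≈g = +-cong (f≈g zero) (∑-cong (f≈g ∘ suc))

  ∑-zero : ∀ {m} {f : Fin m → Carrier} → (∀ i → f i ≈ 0#) → ∑ F m f ≈ 0#
  ∑-zero {zero}  f≈0 = refl
  ∑-zero {suc m} f≈0 = trans (+-cong (f≈0 zero) (∑-zero (f≈0 ∘ suc))) (+-identityˡ 0#)

  ∑-axpy : ∀ {m} p (f g w : Fin m → Carrier) →
           ∑ F m (λ y → (f y + p * g y) * w y) ≈
           ∑ F m (λ y → f y * w y) + p * ∑ F m (λ y → g y * w y)
  ∑-axpy {zero}  p f g w = sym (trans (+-identityˡ _) (zeroʳ p))
  ∑-axpy {suc m} p f g w = trans (+-congˡ (∑-axpy p (f ∘ suc) (g ∘ suc) (w ∘ suc)))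
    (solve 6 (λ p f g w s t → (f :+ p :* g) :* w :+ (s :+ p :* t)
                              := f :* w :+ s :+ p :* (g :* w :+ t)) refl
      p (f zero) (g zero) (w zero) _ _)

  -- Holds because double negation is an applicative functor; it merges finitely many undecidable
  -- zero tests into one.
  ∀-¬¬ : ∀ {a n} {P : Fin n → Set a} → (∀ i → ¬ ¬ P i) → ¬ ¬ (∀ i → P i)
  ∀-¬¬ = Fin.sequence (RawMonad.rawApplicative ¬¬-Monad)

  NonzeroKernel : ∀ {r s} → (Fin r → Fin s → Carrier) → Set _
  NonzeroKernel {r} {s} Q =
    Σ (Fin s → Carrier) λ w →
      (∃ λ y → ¬ w y ≈ 0#) × (∀ x → ∑ F s (λ y → Q x y * w y) ≈ 0#)

  -- Gaussian elimination on the first column. If the column vanishes, the first unit vector is in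
  -- the kernel; otherwise a nonzero entry serves as pivot and both dimensions drop by one. Choosing
  -- between the two cases is what costs the double negation.
  wide⇒kernel : ∀ {r s} (Q : Fin r → Fin s → Carrier) → r < s → ¬ ¬ NonzeroKernel Q
  wide⇒kernel {r} {suc s} Q r<s no-kernel =
    ¬¬-excluded-middle {A = ∃ λ x → ¬ Q x zero ≈ 0#} λ where
      (yes (x , Qx0≉0)) → eliminate Q r<s x Qx0≉0 no-kernel
      (no all≈0) → ∀-¬¬ (λ x Qx0≉0 → all≈0 (x , Qx0≉0)) (no-kernel ∘ unit-kernel)
    where
    unit-kernel : (∀ x → Q x zero ≈ 0#) → NonzeroKernel Q
    unit-kernel Q0≈0 = w , (zero , 1≉0) , λ x →
      trans (+-cong (trans (*-identityʳ _) (Q0≈0 x)) (∑-zero {s} (λ y → zeroʳ _))) (+-identityˡ 0#)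
      where
      w : Fin (suc s) → Carrier
      w zero    = 1#
      w (suc _) = 0#

    eliminate : ∀ {r} (Q : Fin r → Fin (suc s) → Carrier) → r < suc s →
                ∀ i → ¬ Q i zero ≈ 0# → ¬ ¬ NonzeroKernel Q
    eliminate {suc r} Q (s≤s r<s) i q≉0 no-kernel = wide⇒kernel Q′ r<s (no-kernel ∘ extend)
      where
      q = Q i zero
      b = proj₁ (inverse q q≉0)
      qb≈1 = proj₂ (inverse q q≉0)
      Q′ : Fin r → Fin s → Carrier
      Q′ x y = Q (punchIn i x) (suc y) + - (b * Q (punchIn i x) zero) * Q i (suc y)
      extend : NonzeroKernel Q′ → NonzeroKernel Q
      extend (w , (y , wy≉0) , Q′w≈0) = w⁺ , (suc y , wy≉0) , Qw⁺≈0
        where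
        S : Fin (suc r) → Carrier
        S x = ∑ F s (λ y → Q x (suc y) * w y)
        w⁺ : Fin (suc s) → Carrier
        -- Row `i` of the system, solved for the eliminated coordinate.
        w⁺ zero    = - (b * S i)
        w⁺ (suc y) = w y
        Qw⁺≈0 : ∀ x → Q x zero * w⁺ zero + S x ≈ 0#
        Qw⁺≈0 x with i Fin.≟ x
        ... | yes ≡.refl = begin
          q * - (b * S i) + S i  ≈⟨ solve 3 (λ q b s → q :* :- (b :* s) :+ s := s :- (q :* b) :* s) refl q b (S i) ⟩
          S i - q * b * S i      ≈⟨ +-congˡ (-‿cong (trans (*-congʳ qb≈1) (*-identityˡ _))) ⟩
          S i - S i              ≈⟨ -‿inverseʳ _ ⟩
          0#                     ∎
        ... | no i≢x = ≡.subst (λ z → Q z zero * w⁺ zero + S z ≈ 0#) (Fin.punchIn-punchOut i≢x) (begin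
          Q x′ zero * - (b * S i) + S x′    ≈⟨ solve 4 (λ p b s t → p :* :- (b :* s) :+ t := t :+ :- (b :* p) :* s) refl (Q x′ zero) b (S i) (S x′) ⟩
          S x′ + - (b * Q x′ zero) * S i    ≈⟨ ∑-axpy (- (b * Q x′ zero)) (Q x′ ∘ suc) (Q i ∘ suc) w ⟨
          ∑ F s (λ y → Q′ _ y * w y)        ≈⟨ Q′w≈0 (Fin.punchOut i≢x) ⟩
          0#                                ∎)
          where x′ = punchIn i (Fin.punchOut i≢x)

  rank-unique : ∀ {n} {A : Matrix F n} {r s} → HasRank F A r → HasRank F A s → r ≡ s
  rank-unique ((cols , indep) , max) ((cols′ , indep′) , max′) =
    ℕ.≤-antisym (max′ _ cols indep) (max _ cols′ indep′)

  -- Forward substitution: the first row involves only `w zero`, and once that is zero the first row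
  -- and column can be removed.
  triangular-kernel : ∀ {m} (T : Fin m → Fin m → Carrier) →
    (∀ t → ¬ T t t ≈ 0#) → (∀ {t u} → t Fin.< u → T t u ≈ 0#) →
    ∀ (w : Fin m → Carrier) → (∀ t → ∑ F m (λ u → T t u * w u) ≈ 0#) → ∀ t → w t ≈ 0#
  triangular-kernel {suc m} T diag≉0 upper≈0 w Tw≈0 = w≈0
    where
    w₀≈0 : w zero ≈ 0#
    w₀≈0 = cancel-invertible (proj₂ (inverse _ (diag≉0 zero))) (begin
      T zero zero * w zero           ≈⟨ +-identityʳ _ ⟨
      T zero zero * w zero + 0#      ≈⟨ +-congˡ (∑-zero {m} λ u → trans (*-congʳ (upper≈0 (s≤s z≤n))) (zeroˡ _)) ⟨
      T zero zero * w zero + _       ≈⟨ Tw≈0 zero ⟩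
      0#                             ∎)
    w≈0 : ∀ t → w t ≈ 0#
    w≈0 zero    = w₀≈0
    w≈0 (suc t) = triangular-kernel (λ t u → T (suc t) (suc u)) (diag≉0 ∘ suc) (upper≈0 ∘ s≤s) (w ∘ suc)
      (λ t → begin
        ∑ F m _                            ≈⟨ +-identityˡ _ ⟨
        0# + ∑ F m _                       ≈⟨ +-congʳ (trans (*-congˡ w₀≈0) (zeroʳ _)) ⟨
        T (suc t) zero * w zero + ∑ F m _  ≈⟨ Tw≈0 (suc t) ⟩
        0#                                 ∎) t

  -- Rank by skew-symmetric elimination.

  schur : ∀ {n} → Matrix F n → (i j : Fin n) → Carrier → Matrix F n
  schur A i j b x y = (A x y + - (b * A x j) * A i y) + (b * A x i) * A j y

  -- Each `pivot` passes to the Schur complement of the block on rows and columns `i`, `j`, which is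
  -- skew with zero diagonal; `b` is the inverse of its off-diagonal entry. A step lowers the rank
  -- by 2, so the index is half the rank. `A′` is compared with `schur` only up to `_≈_`, so that a
  -- matrix given by another formula can take its place.
  data Reduces {n} : Matrix F n → ℕ → Set (c ⊔ ℓ) where
    vanishing : ∀ {A} → (∀ x y → A x y ≈ 0#) → Reduces A 0
    pivot : ∀ {A A′ p} i j b → A i j * b ≈ 1# →
            A i i ≈ 0# → A j j ≈ 0# → A j i ≈ - A i j →
            (∀ x y → A′ x y ≈ schur A i j b x y) → Reduces A′ p → Reduces A (suc p)

  module _ {n : ℕ} {A A′ : Matrix F n} {i j : Fin n} {b : Carrier}
           (A′≈ : ∀ x y → A′ x y ≈ schur A i j b x y)
           {s : ℕ} (cols : Fin s → Fin n) (w : Fin s → Carrier) where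

    private
      product : Matrix F n → Fin n → Carrier
      product B x = ∑ F s (λ y → B x (cols y) * w y)

    schur-product : ∀ x → product A′ x ≈ product A x + - (b * A x j) * product A i + (b * A x i) * product A j
    schur-product x = begin
      product A′ x
        ≈⟨ ∑-cong (λ y → *-congʳ (A′≈ x (cols y))) ⟩
      ∑ F s (λ y → schur A i j b x (cols y) * w y)
        ≈⟨ ∑-axpy (b * A x i) (λ y → A x (cols y) + - (b * A x j) * A i (cols y)) (A j ∘ cols) w ⟩
      ∑ F s (λ y → (A x (cols y) + - (b * A x j) * A i (cols y)) * w y) + (b * A x i) * product A j
        ≈⟨ +-congʳ (∑-axpy (- (b * A x j)) (A x ∘ cols) (A i ∘ cols) w) ⟩
      product A x + - (b * A x j) * product A i + (b * A x i) * product A j  ∎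

  pivot-columns : ∀ {n p} {A : Matrix F n} → Reduces A p → Fin (p ℕ.* 2) → Fin n
  pivot-columns (pivot i j b _ _ _ _ _ red) zero          = i
  pivot-columns (pivot i j b _ _ _ _ _ red) (suc zero)    = j
  pivot-columns (pivot i j b _ _ _ _ _ red) (suc (suc t)) = pivot-columns red t

  -- Rows `i` and `j` of a relation express `w₁` and `w₀` through the remaining coefficients.
  -- Substituting them turns the relation into one among the pivot columns of the Schur complement,
  -- so those coefficients vanish by induction, and then so do `w₀` and `w₁`.
  pivot-columns-independent : ∀ {n p} {A : Matrix F n} (red : Reduces A p) →
                              IndependentCols F A (pivot-columns red)
  pivot-columns-independent {n} {suc p} {A} (pivot {A′ = A′} i j b ab≈1 Aii≈0 Ajj≈0 Aji≈-Aij A′≈ red) w Aw≈0 = w≈0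
    where
    a = A i j
    cols = pivot-columns red
    w₀ = w zero
    w₁ = w (suc zero)
    w′ : Fin (p ℕ.* 2) → Carrier
    w′ t = w (suc (suc t))
    S : Fin n → Carrier
    S x = ∑ F (p ℕ.* 2) (λ y → A x (cols y) * w′ y)
    Si≈ : S i ≈ - (a * w₁)
    Si≈ = begin
      S i                                          ≈⟨ solve 4 (λ s a u v → s := (#0 :* u :+ (a :* v :+ s)) :- a :* v) refl (S i) a w₀ w₁ ⟩
      (0# * w₀ + (a * w₁ + S i)) - a * w₁          ≈⟨ +-congʳ (+-congʳ (*-congʳ Aii≈0)) ⟨
      (A i i * w₀ + (a * w₁ + S i)) - a * w₁       ≈⟨ +-congʳ (Aw≈0 i) ⟩
      0# - a * w₁                                  ≈⟨ +-identityˡ _ ⟩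
      - (a * w₁)                                   ∎
    Sj≈ : S j ≈ a * w₀
    Sj≈ = begin
      S j                                          ≈⟨ solve 4 (λ s a u v → s := (:- a :* u :+ (#0 :* v :+ s)) :+ a :* u) refl (S j) a w₀ w₁ ⟩
      (- a * w₀ + (0# * w₁ + S j)) + a * w₀        ≈⟨ +-congʳ (+-cong (*-congʳ Aji≈-Aij) (+-congʳ (*-congʳ Ajj≈0))) ⟨
      (A j i * w₀ + (A j j * w₁ + S j)) + a * w₀   ≈⟨ +-congʳ (Aw≈0 j) ⟩
      0# + a * w₀                                  ≈⟨ +-identityˡ _ ⟩
      a * w₀                                       ∎
    A′w′≈0 : ∀ x → ∑ F (p ℕ.* 2) (λ y → A′ x (cols y) * w′ y) ≈ 0#
    A′w′≈0 x = begin
      ∑ F (p ℕ.* 2) (λ y → A′ x (cols y) * w′ y)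
        ≈⟨ schur-product {A = A} A′≈ cols w′ x ⟩
      S x + - (b * A x j) * S i + (b * A x i) * S j
        ≈⟨ +-cong (+-congˡ (*-congˡ Si≈)) (*-congˡ Sj≈) ⟩
      S x + - (b * A x j) * - (a * w₁) + (b * A x i) * (a * w₀)
        ≈⟨ solve 7 (λ s b p q a u v → s :+ :- (b :* q) :* :- (a :* v) :+ (b :* p) :* (a :* u)
                                      := s :+ (a :* b) :* (p :* u :+ q :* v)) refl
             (S x) b (A x i) (A x j) a w₀ w₁ ⟩
      S x + a * b * (A x i * w₀ + A x j * w₁)
        ≈⟨ +-congˡ (trans (*-congʳ ab≈1) (*-identityˡ _)) ⟩
      S x + (A x i * w₀ + A x j * w₁)
        ≈⟨ solve 3 (λ s p q → s :+ (p :+ q) := p :+ (q :+ s)) refl _ _ _ ⟩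
      A x i * w₀ + (A x j * w₁ + S x)
        ≈⟨ Aw≈0 x ⟩
      0#  ∎
    w′≈0 : ∀ t → w′ t ≈ 0#
    w′≈0 = pivot-columns-independent red w′ A′w′≈0
    S≈0 : ∀ x → S x ≈ 0#
    S≈0 x = ∑-zero {p ℕ.* 2} (λ t → trans (*-congˡ (w′≈0 t)) (zeroʳ _))
    w≈0 : ∀ t → w t ≈ 0#
    w≈0 zero          = cancel-invertible ab≈1 (trans (sym Sj≈) (S≈0 j))
    w≈0 (suc zero)    = cancel-invertible ab≈1 (begin
      a * w₁      ≈⟨ solve 1 (λ x → x := :- :- x) refl _ ⟩
      - - (a * w₁) ≈⟨ -‿cong Si≈ ⟨
      - S i       ≈⟨ -‿cong (S≈0 i) ⟩
      - 0#        ≈⟨ solve 0 (:- #0 := #0) refl ⟩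
      0#          ∎)
    w≈0 (suc (suc t)) = w′≈0 t

  pivot-rows : ∀ {n p} {A : Matrix F n} → Reduces A p → Fin (p ℕ.* 2) → Fin n → Carrier
  pivot-rows {A = A} (pivot i j b _ _ _ _ _ red) zero          = A i
  pivot-rows {A = A} (pivot i j b _ _ _ _ _ red) (suc zero)    = A j
  pivot-rows         (pivot i j b _ _ _ _ _ red) (suc (suc t)) = pivot-rows red t

  -- Spanning is expressed dually, through kernels. Every row of `A` is a row of the Schur
  -- complement plus a combination of rows `i` and `j`; the later pivot rows are therefore rows of
  -- successive complements, not of `A`.
  pivot-rows-span : ∀ {n p} {A : Matrix F n} (red : Reduces A p) →
    ∀ {s} (cols : Fin s → Fin n) (w : Fin s → Carrier) →
    (∀ t → ∑ F s (λ y → pivot-rows red t (cols y) * w y) ≈ 0#) →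
    ∀ x → ∑ F s (λ y → A x (cols y) * w y) ≈ 0#
  pivot-rows-span (vanishing A≈0) {s} cols w _ x = ∑-zero {s} (λ y → trans (*-congʳ (A≈0 x _)) (zeroˡ _))
  pivot-rows-span {A = A} (pivot {A′ = A′} i j b ab≈1 Aii≈0 Ajj≈0 Aji≈-Aij A′≈ red) {s} cols w Qw≈0 x = begin
    S x
      ≈⟨ solve 3 (λ s p q → s := s :+ p :* #0 :+ q :* #0) refl (S x) (- (b * A x j)) (b * A x i) ⟩
    S x + - (b * A x j) * 0# + (b * A x i) * 0#
      ≈⟨ +-cong (+-congˡ (*-congˡ (Qw≈0 zero))) (*-congˡ (Qw≈0 (suc zero))) ⟨
    S x + - (b * A x j) * S i + (b * A x i) * S j
      ≈⟨ schur-product {A = A} A′≈ cols w x ⟨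
    ∑ F s (λ y → A′ x (cols y) * w y)
      ≈⟨ pivot-rows-span red cols w (λ t → Qw≈0 (suc (suc t))) x ⟩
    0#  ∎
    where
    S : _ → Carrier
    S x = ∑ F s (λ y → A x (cols y) * w y)

  reduces⇒rank : ∀ {n p} {A : Matrix F n} → Reduces A p → HasRank F A (p ℕ.* 2)
  reduces⇒rank {p = p} {A} red =
    -- More than `2p` columns would give the pivot rows a nonzero kernel vector on them, and that
    -- vector is a relation among the columns.
    (pivot-columns red , pivot-columns-independent red) , λ s cols indep → ℕ.≮⇒≥ λ 2p<s →
      wide⇒kernel (λ t y → pivot-rows red t (cols y)) 2p<s λ where
        (w , (y , wy≉0) , Qw≈0) → wy≉0 (indep w (pivot-rows-span red cols w Qw≈0) y)

  -- Alternating matrices have even rank.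

  Alternating : ∀ {n} → Matrix F n → Set ℓ
  Alternating A = (∀ x → A x x ≈ 0#) × (∀ x y → A y x ≈ - A x y)

  -- A diagonal entry equals its own negative, so twice it is zero, and 2 is invertible.
  skew⇒alternating : CharNot2 F → ∀ {n} {A : Matrix F n} → (∀ x y → A y x ≈ - A x y) → Alternating A
  skew⇒alternating 2≉0 {A = A} skew = (λ x → cancel-invertible (proj₂ (inverse _ 2≉0)) (begin
    (1# + 1#) * A x x   ≈⟨ trans (distribʳ _ _ _) (+-cong (*-identityˡ _) (*-identityˡ _)) ⟩
    A x x + A x x       ≈⟨ +-congˡ (skew x x) ⟩
    A x x - A x x       ≈⟨ -‿inverseʳ _ ⟩
    0#                  ∎)) , skew

  schur-alternating : ∀ {n} {A : Matrix F n} {i j b} → Alternating A → Alternating (schur A i j b)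
  schur-alternating {A = A} {i} {j} {b} (diag , skew) =
    (λ x → begin
      (A x x + - (b * A x j) * A i x) + (b * A x i) * A j x
        ≈⟨ +-cong (+-cong (diag x) (*-congˡ (skew x i))) (*-congˡ (skew x j)) ⟩
      (0# + - (b * A x j) * - A x i) + (b * A x i) * - A x j
        ≈⟨ solve 3 (λ b p q → (#0 :+ :- (b :* q) :* :- p) :+ (b :* p) :* :- q := #0) refl b (A x i) (A x j) ⟩
      0#  ∎) ,
    (λ x y → begin
      (A y x + - (b * A y j) * A i x) + (b * A y i) * A j x
        ≈⟨ +-cong (+-cong (skew x y) (*-cong (-‿cong (*-congˡ (skew j y))) (skew x i))) (*-cong (*-congˡ (skew i y)) (skew x j)) ⟩
      (- A x y + - (b * - A j y) * - A x i) + (b * - A i y) * - A x j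
        ≈⟨ solve 6 (λ a b jy xi iy xj → (:- a :+ :- (b :* :- jy) :* :- xi) :+ (b :* :- iy) :* :- xj
                       := :- ((a :+ :- (b :* xj) :* iy) :+ (b :* xi) :* jy)) refl
             (A x y) b (A j y) (A x i) (A i y) (A x j) ⟩
      - schur A i j b x y  ∎)

  -- Zero tests in F exist only under double negation; that suffices because ranks are
  -- compared in ℕ, where the order is decidable.
  alternating⇒reduces : ∀ {n} {A : Matrix F n} → Alternating A → ¬ ¬ ∃ (Reduces A)
  alternating⇒reduces {n} alt = go (allFin n) alt (λ x → inj₁ (∈-allFin x))
    where
    -- The invariant is that every row off the list is zero. Pivoting in row `z` clears that row and
    -- keeps zero rows zero, so the list bounds the number of pivots.
    go : ∀ (xs : List (Fin n)) {A} → Alternating A →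
         (∀ x → x ∈ xs ⊎ (∀ y → A x y ≈ 0#)) → ¬ ¬ ∃ (Reduces A)
    go [] {A} alt rows k = k (0 , vanishing λ x y → case rows x of λ where
      (inj₂ Ax≈0) → Ax≈0 y)
    go (z ∷ xs) {A} alt@(diag , skew) rows k = ¬¬-excluded-middle {A = ∃ λ y → ¬ A z y ≈ 0#} λ where
        (no none) → ∀-¬¬ (λ y Azy≉0 → none (y , Azy≉0)) λ Az≈0 → go xs alt (drop-zero-row Az≈0) k
        (yes (y , Azy≉0)) → go xs {schur A z y (proj₁ (inverse _ Azy≉0))} (schur-alternating alt) (rows′ y Azy≉0) λ where
          (p , red) → k (suc p , pivot z y _ (proj₂ (inverse _ Azy≉0)) (diag z) (diag y) (skew z y) (λ _ _ → refl) red)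
      where
      drop-zero-row : (∀ y → A z y ≈ 0#) → ∀ x → x ∈ xs ⊎ (∀ y → A x y ≈ 0#)
      drop-zero-row Az≈0 x with rows x
      ... | inj₁ (here ≡.refl) = inj₂ Az≈0
      ... | inj₁ (there x∈)    = inj₁ x∈
      ... | inj₂ Ax≈0          = inj₂ Ax≈0
      rows′ : ∀ y (Azy≉0 : ¬ A z y ≈ 0#) x → x ∈ xs ⊎ (∀ u → schur A z y (proj₁ (inverse _ Azy≉0)) x u ≈ 0#)
      rows′ y Azy≉0 x with rows x
      ... | inj₁ (there x∈)    = inj₁ x∈
      ... | inj₁ (here ≡.refl) = inj₂ λ u → begin
        (A z u + - (b * A z y) * A z u) + (b * A z z) * A y u
          ≈⟨ +-congˡ (*-congʳ (*-congˡ (diag z))) ⟩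
        (A z u + - (b * A z y) * A z u) + (b * 0#) * A y u
          ≈⟨ solve 4 (λ u b a v → (u :+ :- (b :* a) :* u) :+ (b :* #0) :* v := u :- (a :* b) :* u) refl (A z u) b (A z y) (A y u) ⟩
        A z u - A z y * b * A z u
          ≈⟨ +-congˡ (-‿cong (trans (*-congʳ (proj₂ (inverse _ Azy≉0))) (*-identityˡ _))) ⟩
        A z u - A z u
          ≈⟨ -‿inverseʳ _ ⟩
        0#  ∎
        where b = proj₁ (inverse _ Azy≉0)
      ... | inj₂ Ax≈0          = inj₂ λ u → begin
        (A x u + - (b * A x y) * A z u) + (b * A x z) * A y u
          ≈⟨ +-cong (+-cong (Ax≈0 u) (*-congʳ (-‿cong (*-congˡ (Ax≈0 y))))) (*-congʳ (*-congˡ (Ax≈0 z))) ⟩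
        (0# + - (b * 0#) * A z u) + (b * 0#) * A y u
          ≈⟨ solve 3 (λ b p q → (#0 :+ :- (b :* #0) :* p) :+ (b :* #0) :* q := #0) refl b _ _ ⟩
        0#  ∎
        where b = proj₁ (inverse _ Azy≉0)

  alternating-rank-even : ∀ {n} {A : Matrix F n} {s} → Alternating A → HasRank F A s → ¬ ¬ ∃ λ p → s ≡ p ℕ.* 2
  alternating-rank-even {A = A} alt rank k = alternating⇒reduces {A = A} alt λ where
    (p , red) → k (p , rank-unique {A = A} rank (reduces⇒rank red))

module KPaths where
  open import Data.Nat using (_+_; _≡ᵇ_)
  open import Relation.Binary.PropositionalEquality
  open import Algebra.Properties.CommutativeMonoid.Sum ℕ.+-0-commutativeMonoid using (sum; sum-permute)

  -- Cardinalities of decidable subsets of `Fin n`.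

  count-cong : ∀ {n} {p q : Fin n → Bool} → (∀ i → p i ≡ q i) → count p ≡ count q
  count-cong {zero}  p≗q = refl
  count-cong {suc n} p≗q =
    cong₂ _+_ (cong (if_then 1 else 0) (p≗q zero)) (count-cong (p≗q ∘ suc))

  count-⊆ : ∀ {n} {p q : Fin n → Bool} → (∀ i → p i ≡ true → q i ≡ true) → count p ≤ count q
  count-⊆ {zero}          p⊆q = z≤n
  count-⊆ {suc n} {p} {q} p⊆q = ℕ.+-mono-≤ head (count-⊆ (p⊆q ∘ suc))
    where
    head : (if p zero then 1 else 0) ≤ (if q zero then 1 else 0)
    head with p zero in p₀
    ... | true rewrite p⊆q zero p₀ = ℕ.≤-refl
    ... | false = z≤n

  count-full : ∀ {n} {p : Fin n → Bool} → (∀ i → p i ≡ true) → count p ≡ n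
  count-full {zero}  full = refl
  count-full {suc n} full rewrite full zero = cong suc (count-full (full ∘ suc))

  count≤n : ∀ {n} (p : Fin n → Bool) → count p ≤ n
  count≤n {n} p = subst (count p ≤_) (count-full {n} {λ _ → true} (λ _ → refl)) (count-⊆ {p = p} (λ _ _ → refl))

  count-witness : ∀ {n} (p : Fin n → Bool) → 1 ≤ count p → ∃ λ i → p i ≡ true
  count-witness {suc n} p 1≤count with p zero in p₀
  ... | true  = zero , p₀
  ... | false = let i , pi = count-witness (p ∘ suc) 1≤count in suc i , pi

  count-last : ∀ {n} (p : Fin (suc n) → Bool) → p (fromℕ n) ≡ false → count p ≡ count (p ∘ inject₁)
  count-last {zero}  p e rewrite e = refl
  count-last {suc n} p e = cong ((if p zero then 1 else 0) +_) (count-last (p ∘ suc) e)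

  count-permute : ∀ {n} (p : Fin n → Bool) (σ : Permutation′ n) → count p ≡ count (p ∘ (σ ⟨$⟩ʳ_))
  count-permute p σ = trans (count-sum p) (trans (sum-permute _ σ) (sym (count-sum (p ∘ (σ ⟨$⟩ʳ_)))))
    where
    count-sum : ∀ {n} (p : Fin n → Bool) → count p ≡ sum (λ i → if p i then 1 else 0)
    count-sum {zero}  p = refl
    count-sum {suc n} p = cong ((if p zero then 1 else 0) +_) (count-sum (p ∘ suc))

  insert : ∀ {n} → Fin n → (Fin n → Bool) → Fin n → Bool
  insert a p i = if does (i Fin.≟ a) then true else p i

  insert-other : ∀ {n} {a i} (p : Fin n → Bool) → i ≢ a → insert a p i ≡ p i
  insert-other {a = a} {i} p i≢a rewrite dec-false (i Fin.≟ a) i≢a = refl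

  insert-true : ∀ {n} a (p : Fin n → Bool) i → insert a p i ≡ true → i ≡ a ⊎ p i ≡ true
  insert-true a p i e with i Fin.≟ a
  ... | yes i≡a = inj₁ i≡a
  ... | no  _   = inj₂ e

  count-insert : ∀ {n} a (p : Fin n → Bool) → p a ≡ false → count (insert a p) ≡ suc (count p)
  count-insert {suc n} zero p p₀ rewrite p₀ =
    cong suc (count-cong λ i → insert-other {a = zero} {i = suc i} p (λ ()))
  count-insert {suc n} (suc a) p pa = trans
    (cong ((if p zero then 1 else 0) +_)
      (trans (count-cong tail) (count-insert a (p ∘ suc) pa)))
    (ℕ.+-suc _ _)
    where
    tail : ∀ i → insert (suc a) p (suc i) ≡ insert a (p ∘ suc) i
    tail i with i Fin.≟ a
    ... | yes refl = refl
    ... | no  _    = refl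

  count-two-missing : ∀ {n} {a b} (p : Fin n → Bool) → a ≢ b → p a ≡ false → p b ≡ false → 2 + count p ≤ n
  count-two-missing {a = a} {b} p a≢b pa pb =
    subst (_≤ _) (trans (count-insert b (insert a p) (trans (insert-other p (a≢b ∘ sym)) pb)) (cong suc (count-insert a p pa)))
      (count≤n (insert b (insert a p)))

  three≤count : ∀ {n} {a b c} (p : Fin n → Bool) → a ≢ b → a ≢ c → b ≢ c →
                p a ≡ true → p b ≡ true → p c ≡ true → 3 ≤ count p
  three≤count {n} {a} {b} {c} p a≢b a≢c b≢c pa pb pc = begin
    3                      ≤⟨ ℕ.m≤m+n 3 _ ⟩
    3 + count ∅            ≡⟨ cong (2 +_) (count-insert a ∅ refl) ⟨
    2 + count ⟨a⟩          ≡⟨ cong suc (count-insert b ⟨a⟩ (insert-other ∅ (a≢b ∘ sym))) ⟨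
    1 + count ⟨ab⟩         ≡⟨ count-insert c ⟨ab⟩ (trans (insert-other ⟨a⟩ (b≢c ∘ sym)) (insert-other ∅ (a≢c ∘ sym))) ⟨
    count (insert c ⟨ab⟩)  ≤⟨ count-⊆ abc⊆p ⟩
    count p                ∎
    where
    open ℕ.≤-Reasoning
    ∅ ⟨a⟩ ⟨ab⟩ : Fin n → Bool
    ∅ _ = false
    ⟨a⟩ = insert a ∅
    ⟨ab⟩ = insert b ⟨a⟩
    abc⊆p : ∀ i → insert c ⟨ab⟩ i ≡ true → p i ≡ true
    abc⊆p i e with insert-true c ⟨ab⟩ i e
    ... | inj₁ refl = pc
    ... | inj₂ e₁ with insert-true b ⟨a⟩ i e₁
    ...   | inj₁ refl = pb
    ...   | inj₂ e₂ with insert-true a ∅ i e₂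
    ...     | inj₁ refl = pa

  -- A missing element would make the larger set larger still.
  count-equal : ∀ {n} {p q : Fin n → Bool} → (∀ i → p i ≡ true → q i ≡ true) → count q ≤ count p →
                ∀ i → q i ≡ true → p i ≡ true
  count-equal {p = p} {q} p⊆q q≤p i qi with p i in pi
  ... | true  = refl
  ... | false = contradiction
    (subst (_≤ count q) (count-insert i p pi) (count-⊆ λ j e → case insert-true i p j e of λ where
      (inj₁ refl) → qi
      (inj₂ pj)   → p⊆q j pj))
    (ℕ.<⇒≱ (s≤s q≤p))

  -- Serves to find the vertex that a new vertex replaces in the last clique. Adding one missing `x`
  -- to `p` already gives a subset of `q` of full size, hence `q` itself.
  unique-missing : ∀ {n} (p q : Fin n → Bool) → (∀ i → p i ≡ true → q i ≡ true) → count q ≡ suc (count p) →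
                   ∃ λ x → q x ≡ true × p x ≡ false × (∀ y → q y ≡ true → p y ≡ false → y ≡ x)
  unique-missing {n} p q p⊆q size with Fin.any? (λ x → (q x ≟ᵇ true) ×-dec (p x ≟ᵇ false))
  ... | yes (x , qx , px) = x , qx , px , λ y qy py → case insert-true x p y (px⊇q y qy) of λ where
        (inj₁ y≡x) → y≡x
        (inj₂ py′) → contradiction (trans (sym py) py′) λ ()
    where
    px⊇q : ∀ y → q y ≡ true → insert x p y ≡ true
    px⊇q = count-equal (λ i e → case insert-true x p i e of λ where
        (inj₁ refl) → qx
        (inj₂ pi)   → p⊆q i pi)
      (ℕ.≤-reflexive (trans size (sym (count-insert x p px))))
  ... | no none = contradiction
    (count-⊆ λ i qi → ¬-not λ pi → none (i , qi , pi))
    (ℕ.<⇒≱ (ℕ.≤-reflexive (sym size)))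

  -- Simplicial vertices of k-trees.

  Simplicial : ∀ {n} → Graph n → Fin n → Set
  Simplicial G i = ∀ a b → adj G i a ≡ true → adj G i b ≡ true → a ≢ b → adj G a b ≡ true

  adj⇒≢ : ∀ {n} (G : Graph n) {i j} → adj G i j ≡ true → i ≢ j
  adj⇒≢ G e refl = contradiction (trans (sym e) (irrefl G _)) λ ()

  adj-sym : ∀ {n} (G : Graph n) {i j} → adj G i j ≡ true → adj G j i ≡ true
  adj-sym G e = trans (Graph.sym G _ _) e

  count-closed-neighbourhood : ∀ {n} (G : Graph n) i → count (insert i (adj G i)) ≡ suc (degree G i)
  count-closed-neighbourhood G i = count-insert i (adj G i) (irrefl G i)

  module Isomorphism {n : ℕ} (G H : Graph n) (σ : Permutation′ n)
                     (iso : ∀ i j → adj H (σ ⟨$⟩ʳ i) (σ ⟨$⟩ʳ j) ≡ adj G i j) where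

    iso⁻¹ : ∀ i j → adj H i j ≡ adj G (σ ⟨$⟩ˡ i) (σ ⟨$⟩ˡ j)
    iso⁻¹ i j = trans (sym (cong₂ (adj H) (inverseʳ σ) (inverseʳ σ))) (iso _ _)

    injective : ∀ {i j} → σ ⟨$⟩ʳ i ≡ σ ⟨$⟩ʳ j → i ≡ j
    injective e = trans (sym (inverseˡ σ)) (trans (cong (σ ⟨$⟩ˡ_) e) (inverseˡ σ))

    injective⁻¹ : ∀ {i j} → σ ⟨$⟩ˡ i ≡ σ ⟨$⟩ˡ j → i ≡ j
    injective⁻¹ e = trans (sym (inverseʳ σ)) (trans (cong (σ ⟨$⟩ʳ_) e) (inverseʳ σ))

    simplicial-image : ∀ {i} → Simplicial G i → Simplicial H (σ ⟨$⟩ʳ i)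
    simplicial-image {i} s a b ia ib a≢b = trans (iso⁻¹ a b)
      (s _ _ (neighbour ia) (neighbour ib) (a≢b ∘ injective⁻¹))
      where
      neighbour : ∀ {a} → adj H (σ ⟨$⟩ʳ i) a ≡ true → adj G i (σ ⟨$⟩ˡ a) ≡ true
      neighbour e = trans (cong (λ x → adj G x _) (sym (inverseˡ σ))) (trans (sym (iso⁻¹ _ _)) e)

    simplicial-preimage : ∀ {i} → Simplicial H i → Simplicial G (σ ⟨$⟩ˡ i)
    simplicial-preimage {i} s a b ia ib a≢b = trans (sym (iso a b))
      (s _ _ (neighbour ia) (neighbour ib) (a≢b ∘ injective))
      where
      neighbour : ∀ {a} → adj G (σ ⟨$⟩ˡ i) a ≡ true → adj H i (σ ⟨$⟩ʳ a) ≡ true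
      neighbour e = trans (cong (λ x → adj H x _) (sym (inverseʳ σ))) (trans (iso _ _) e)

    degree-preimage : ∀ i → degree H i ≡ degree G (σ ⟨$⟩ˡ i)
    degree-preimage i = trans (count-permute (adj H i) σ)
      (count-cong {n} λ j → trans (iso⁻¹ i (σ ⟨$⟩ʳ j)) (cong (adj G _) (inverseˡ σ)))

  module AddedVertex {n : ℕ} (G : Graph (suc n)) where
    H : Graph n
    H = dropLast G

    N : Fin n → Bool
    N i = adj G (fromℕ n) (inject₁ i)

    simplicial-restrict : ∀ {i} → Simplicial G (inject₁ i) → Simplicial H i
    simplicial-restrict s a b ia ib a≢b = s _ _ ia ib (a≢b ∘ Fin.inject₁-injective)

    simplicial-extend : ∀ {i} → Simplicial H i → N i ≡ false → Simplicial G (inject₁ i)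
    simplicial-extend {i} s i∉N a b ia ib a≢b with view a | view b
    ... | ‵fromℕ | _      = contradiction (trans (sym i∉N) (adj-sym G ia)) λ ()
    ... | _      | ‵fromℕ = contradiction (trans (sym i∉N) (adj-sym G ib)) λ ()
    ... | ‵inj₁ _ | ‵inj₁ _ = s _ _ ia ib (a≢b ∘ cong inject₁)

    last-simplicial : (∀ i j → N i ≡ true → N j ≡ true → i ≢ j → adj H i j ≡ true) → Simplicial G (fromℕ n)
    last-simplicial clique a b wa wb a≢b with view a | view b
    ... | ‵fromℕ | _      = contradiction refl (adj⇒≢ G wa)
    ... | _      | ‵fromℕ = contradiction refl (adj⇒≢ G wb)
    ... | ‵inj₁ _ | ‵inj₁ _ = clique _ _ wa wb (a≢b ∘ cong inject₁)

    -- A simplicial neighbour i of the added vertex would force its k + 1 closed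
    -- neighbours in H into the k-set N.
    neighbour-not-simplicial : ∀ {i} → count N ≤ degree H i → N i ≡ true → ¬ Simplicial G (inject₁ i)
    neighbour-not-simplicial {i} N≤deg i∈N s = ℕ.<⇒≱ (s≤s N≤deg) (begin
      suc (degree H i)              ≡⟨ count-closed-neighbourhood H i ⟨
      count (insert i (adj H i))    ≤⟨ count-⊆ (λ j e → case insert-true i (adj H i) j e of λ where
                                         (inj₁ refl) → i∈N
                                         (inj₂ ij)   → s (fromℕ n) (inject₁ j) (adj-sym G i∈N) ij Fin.fromℕ≢inject₁) ⟩
      count N                       ∎)
      where open ℕ.≤-Reasoning

  ktree-size : ∀ {k n G} → KTree k n G → suc k ≤ n
  ktree-size (base _ _)        = ℕ.≤-refl
  ktree-size (step _ t _ _)    = ℕ.m≤n⇒m≤1+n (ktree-size t)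
  ktree-size (iso _ _ _ _ t)   = ktree-size t

  minimal⇒complete : ∀ {k n G} → KTree k n G → n ≡ suc k → IsComplete G
  minimal⇒complete (base _ complete) _ = complete
  minimal⇒complete (step _ t _ _) n≡1+k =
    contradiction (ktree-size t) (ℕ.<⇒≱ (ℕ.≤-reflexive n≡1+k))
  minimal⇒complete (iso G H σ e t) n≡1+k i j i≢j =
    trans (iso⁻¹ i j) (minimal⇒complete t n≡1+k _ _ (i≢j ∘ injective⁻¹))
    where open Isomorphism G H σ e

  -- Through this lemma the degree count in `KPath` bounds the number of simplicial vertices. In a
  -- `step`, an old vertex inside `N` cannot be simplicial, and one outside `N` keeps its degree.
  simplicial⇒degree : ∀ {k n G} → KTree k n G → ∀ {i} → Simplicial G i → degree G i ≡ k
  simplicial⇒degree (base G complete) {i} _ = ℕ.suc-injective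
    (trans (sym (count-closed-neighbourhood G i)) (count-full full))
    where
    full : ∀ j → insert i (adj G i) j ≡ true
    full j with j Fin.≟ i
    ... | yes _   = refl
    ... | no  j≢i = complete i j (j≢i ∘ sym)
  simplicial⇒degree {n = suc n} (step G t |N|≡k clique) {i} s with view i
  ... | ‵fromℕ = trans (count-last (adj G (fromℕ n)) (irrefl G (fromℕ n))) |N|≡k
  ... | ‵inj₁ {i = j} _ with adj G (fromℕ n) (inject₁ j) in j∈N
  ...   | true  = contradiction s (neighbour-not-simplicial
            (ℕ.≤-reflexive (trans |N|≡k (sym (simplicial⇒degree t (simplicial-restrict s))))) j∈N)
    where open AddedVertex G
  ...   | false = trans (count-last (adj G (inject₁ j)) (trans (Graph.sym G _ _) j∈N))
      (simplicial⇒degree t (AddedVertex.simplicial-restrict G s))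
  simplicial⇒degree (iso G H σ e t) {i} s =
    trans (degree-preimage i) (simplicial⇒degree t (simplicial-preimage s))
    where open Isomorphism G H σ e

  -- In a `step` no simplicial vertex is adjacent to the added one, so both are old and outside `N`.
  -- By induction the old graph has `k + 1` vertices, of which the `k`-set `N` can miss only one.
  adjacent-simplicial⇒minimal : ∀ {k n G} → KTree k n G → ∀ {a b} →
    Simplicial G a → Simplicial G b → adj G a b ≡ true → n ≡ suc k
  adjacent-simplicial⇒minimal (base _ _) _ _ _ = refl
  adjacent-simplicial⇒minimal {k} {suc n} (step G t |N|≡k clique) {a} {b} sa sb ab with view a | view b
  ... | ‵fromℕ | ‵fromℕ = contradiction refl (adj⇒≢ G ab)
  ... | ‵fromℕ | ‵inj₁ _ = contradiction sb (AddedVertex.neighbour-not-simplicial G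
          (ℕ.≤-reflexive (trans |N|≡k (sym (simplicial⇒degree t (AddedVertex.simplicial-restrict G sb))))) ab)
  ... | ‵inj₁ _ | ‵fromℕ = contradiction sa (AddedVertex.neighbour-not-simplicial G
          (ℕ.≤-reflexive (trans |N|≡k (sym (simplicial⇒degree t (AddedVertex.simplicial-restrict G sa))))) (adj-sym G ab))
  ... | ‵inj₁ {i = i} _ | ‵inj₁ {i = j} _ = contradiction
          (subst (λ c → 2 + c ≤ n) |N|≡k (count-two-missing N (adj⇒≢ H ab) (outside sa) (outside sb)))
          (ℕ.<⇒≱ (s≤s (ℕ.≤-reflexive (adjacent-simplicial⇒minimal t (simplicial-restrict sa) (simplicial-restrict sb) ab))))
    where
    open AddedVertex G
    outside : ∀ {i} → Simplicial G (inject₁ i) → N i ≡ false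
    outside s = ¬-not λ i∈N → neighbour-not-simplicial
      (ℕ.≤-reflexive (trans |N|≡k (sym (simplicial⇒degree t (simplicial-restrict s))))) i∈N s
  adjacent-simplicial⇒minimal (iso G H σ e t) sa sb ab =
    adjacent-simplicial⇒minimal t (simplicial-preimage sa) (simplicial-preimage sb) (trans (sym (iso⁻¹ _ _)) ab)
    where open Isomorphism G H σ e

  -- Interval models of k-paths.

  -- G as the intersection graph of integer intervals [L i, R i] ⊆ [0, m]. The k + 1
  -- vertices whose interval contains t form the t-th maximal clique of the k-path.
  record IntervalModel (k m : ℕ) {n : ℕ} (G : Graph n) : Set where
    field
      L R colour : Fin n → ℕ
      size : n ≡ suc (m + k)
      L≤R : ∀ i → L i ≤ R i
      R≤m : ∀ i → R i ≤ m
      adj⇒meet : ∀ {i j} → adj G i j ≡ true → L i ≤ R j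
      meet⇒adj : ∀ {i j} → i ≢ j → L i ≤ R j → L j ≤ R i → adj G i j ≡ true
      colour-adj : ∀ {i j} → adj G i j ≡ true → colour i ≢ colour j
      colour-next : ∀ {i j} → suc (R i) ≡ L j → colour i ≡ colour j
      -- That `r` and `l` differ makes them adjacent, both intervals containing `t`; this yields the
      -- nonzero diagonal of the lower bound and the pivots of the upper bound.
      ends : ∀ t → t ≤ m → ∃₂ λ r l → r ≢ l × R r ≡ t × L l ≡ t
      -- The end cliques are exempt from uniqueness: all of `Q 0` has `L = 0`, and all of `Q m` has
      -- `R = m`.
      L-unique : ∀ {i j} → 0 < L i → L i ≡ L j → i ≡ j
      R-unique : ∀ {i j} → R i < m → R i ≡ R j → i ≡ j

    L≤m : ∀ i → L i ≤ m
    L≤m i = ℕ.≤-trans (L≤R i) (R≤m i)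

  module _ {k m n : ℕ} {G : Graph n} (M : IntervalModel k m G) where
    open IntervalModel M

    private
      ∸-<⇒0< : ∀ {a} → m ∸ a < m → 0 < a
      ∸-<⇒0< {zero}  m<m = contradiction m<m (ℕ.n≮n m)
      ∸-<⇒0< {suc a} _   = s≤s z≤n

      next : ∀ {i j} → suc (m ∸ L i) ≡ m ∸ R j → suc (R j) ≡ L i
      next {i} {j} e = ℕ.+-cancelʳ-≡ (m ∸ L i) _ _ (begin
        suc (R j + (m ∸ L i))  ≡⟨ ℕ.+-suc (R j) _ ⟨
        R j + suc (m ∸ L i)    ≡⟨ cong (R j +_) e ⟩
        R j + (m ∸ R j)        ≡⟨ ℕ.m+[n∸m]≡n (R≤m j) ⟩
        m                      ≡⟨ ℕ.m+[n∸m]≡n (L≤m i) ⟨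
        L i + (m ∸ L i)        ∎)
        where open ≡-Reasoning

    -- Allows a new vertex to be attached at the end 0, although `Extension` treats only the end
    -- `m`.
    reverse : IntervalModel k m G
    reverse = record
      { L = λ i → m ∸ R i
      ; R = λ i → m ∸ L i
      ; colour = colour
      ; size = size
      ; L≤R = λ i → ℕ.∸-monoʳ-≤ m (L≤R i)
      ; R≤m = λ i → ℕ.m∸n≤m m (L i)
      ; adj⇒meet = λ e → ℕ.∸-monoʳ-≤ m (adj⇒meet (adj-sym G e))
      ; meet⇒adj = λ i≢j ij ji → meet⇒adj i≢j (ℕ.∸-cancelʳ-≤ (L≤m _) ji) (ℕ.∸-cancelʳ-≤ (L≤m _) ij)
      ; colour-adj = colour-adj
      ; colour-next = sym ∘ colour-next ∘ next
      ; ends = λ t t≤m → let r , l , r≢l , Rr , Ll = ends (m ∸ t) (ℕ.m∸n≤m m t) in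
          l , r , r≢l ∘ sym , trans (cong (m ∸_) Ll) (ℕ.m∸[m∸n]≡n t≤m) , trans (cong (m ∸_) Rr) (ℕ.m∸[m∸n]≡n t≤m)
      ; L-unique = λ {i} {j} 0< e → R-unique (ℕ.m∸n≢0⇒n<m (ℕ.>⇒≢ 0<)) (ℕ.∸-cancelˡ-≡ (R≤m i) (R≤m j) e)
      ; R-unique = λ {i} {j} <m e → L-unique (∸-<⇒0< <m) (ℕ.∸-cancelˡ-≡ (L≤m i) (L≤m j) e)
      }

    -- The interval is the single point `m`, so all neighbours contain `m` and meet there.
    L≡m⇒simplicial : ∀ {i} → L i ≡ m → Simplicial G i
    L≡m⇒simplicial {i} Li≡m a b ia ib a≢b = meet⇒adj a≢b
      (ℕ.≤-trans (L≤m a) (subst (_≤ R b) Li≡m (adj⇒meet ib)))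
      (ℕ.≤-trans (L≤m b) (subst (_≤ R a) Li≡m (adj⇒meet ia)))

  transport : ∀ {k m n} (G H : Graph n) (σ : Permutation′ n) →
              (∀ i j → adj H (σ ⟨$⟩ʳ i) (σ ⟨$⟩ʳ j) ≡ adj G i j) →
              IntervalModel k m G → IntervalModel k m H
  transport G H σ e M = record
    { L = L ∘ (σ ⟨$⟩ˡ_)
    ; R = R ∘ (σ ⟨$⟩ˡ_)
    ; colour = colour ∘ (σ ⟨$⟩ˡ_)
    ; size = size
    ; L≤R = λ i → L≤R _
    ; R≤m = λ i → R≤m _
    ; adj⇒meet = λ ij → adj⇒meet (trans (sym (iso⁻¹ _ _)) ij)
    ; meet⇒adj = λ i≢j p q → trans (iso⁻¹ _ _) (meet⇒adj (i≢j ∘ injective⁻¹) p q)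
    ; colour-adj = λ ij → colour-adj (trans (sym (iso⁻¹ _ _)) ij)
    ; colour-next = colour-next
    ; ends = λ t t≤m → let r , l , r≢l , Rr , Ll = ends t t≤m in
        σ ⟨$⟩ʳ r , σ ⟨$⟩ʳ l , r≢l ∘ injective , trans (cong R (inverseˡ σ)) Rr , trans (cong L (inverseˡ σ)) Ll
    ; L-unique = λ p q → injective⁻¹ (L-unique p q)
    ; R-unique = λ p q → injective⁻¹ (R-unique p q)
    }
    where
    open IntervalModel M
    open Isomorphism G H σ e

  complete-model : ∀ {k n} → 1 ≤ k → n ≡ suc k → (G : Graph n) → IsComplete G → IntervalModel k 0 G
  complete-model (s≤s _) refl G complete = record
    { L = λ _ → 0
    ; R = λ _ → 0
    ; colour = toℕ
    ; size = refl
    ; L≤R = λ _ → z≤n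
    ; R≤m = λ _ → z≤n
    ; adj⇒meet = λ _ → z≤n
    ; meet⇒adj = λ i≢j _ _ → complete _ _ i≢j
    ; colour-adj = λ ij → adj⇒≢ G ij ∘ Fin.toℕ-injective
    ; colour-next = λ ()
    -- The second vertex exists because `1 ≤ k`.
    ; ends = λ { zero z≤n → zero , suc zero , (λ ()) , refl , refl }
    ; L-unique = λ ()
    ; R-unique = λ ()
    }

  snoc : ∀ {A : Set} {n} → (Fin n → A) → A → Fin (suc n) → A
  snoc {n = zero}  f a _       = a
  snoc {n = suc n} f a zero    = f zero
  snoc {n = suc n} f a (suc i) = snoc (f ∘ suc) a i

  snoc-inject₁ : ∀ {A : Set} {n} (f : Fin n → A) a i → snoc f a (inject₁ i) ≡ f i
  snoc-inject₁ f a zero    = refl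
  snoc-inject₁ f a (suc i) = snoc-inject₁ (f ∘ suc) a i

  snoc-fromℕ : ∀ {A : Set} {n} (f : Fin n → A) a → snoc f a (fromℕ n) ≡ a
  snoc-fromℕ {n = zero}  f a = refl
  snoc-fromℕ {n = suc n} f a = snoc-fromℕ (f ∘ suc) a

  -- The added vertex becomes the point `m + 1`, and the intervals of `N` are stretched to reach it.
  -- Since `L c = m`, the closed neighbourhood of `c` is the last clique `Q m`; it contains the
  -- clique `N` and exceeds it by one vertex `x`, the one being replaced.
  module Extension {k m n : ℕ} (G : Graph (suc n)) (t : KTree k n (dropLast G))
    (|N|≡k : count (AddedVertex.N G) ≡ k)
    (clique : ∀ i j → AddedVertex.N G i ≡ true → AddedVertex.N G j ≡ true → i ≢ j →
              adj (dropLast G) i j ≡ true)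
    (M : IntervalModel k m (dropLast G))
    (c : Fin n) (c∈N : AddedVertex.N G c ≡ true) (Lc≡m : IntervalModel.L M c ≡ m) where

    open AddedVertex G
    open IntervalModel M

    private
      m≤R : ∀ {i} → adj H c i ≡ true → m ≤ R i
      m≤R {i} ci = subst (_≤ R i) Lc≡m (adj⇒meet ci)

      N⇒closed-neighbour : ∀ i → N i ≡ true → insert c (adj H c) i ≡ true
      N⇒closed-neighbour i i∈N with i Fin.≟ c
      ... | yes _   = refl
      ... | no  i≢c = clique c i c∈N i∈N (i≢c ∘ sym)

      R-closed-neighbour : ∀ i → insert c (adj H c) i ≡ true → R i ≡ m
      R-closed-neighbour i e = ℕ.≤-antisym (R≤m i) (case insert-true c (adj H c) i e of λ where
        (inj₁ refl) → subst (_≤ R c) Lc≡m (L≤R c)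
        (inj₂ ci)   → m≤R ci)

      R≡m⇒closed-neighbour : ∀ i → R i ≡ m → insert c (adj H c) i ≡ true
      R≡m⇒closed-neighbour i Ri≡m with i Fin.≟ c
      ... | yes _   = refl
      ... | no  i≢c = meet⇒adj (i≢c ∘ sym)
            (subst (L c ≤_) (sym Ri≡m) (L≤m c))
            (ℕ.≤-trans (L≤m i) (subst (_≤ R c) Lc≡m (L≤R c)))

      dropped : ∃ λ x → insert c (adj H c) x ≡ true × N x ≡ false ×
                        (∀ y → insert c (adj H c) y ≡ true → N y ≡ false → y ≡ x)
      dropped = unique-missing N (insert c (adj H c)) N⇒closed-neighbour
        (trans (count-closed-neighbourhood H c)
          (cong suc (trans (simplicial⇒degree t (L≡m⇒simplicial M Lc≡m)) (sym |N|≡k))))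

      x : Fin n
      x = proj₁ dropped

      x∉N : N x ≡ false
      x∉N = proj₁ (proj₂ (proj₂ dropped))

      Rx≡m : R x ≡ m
      Rx≡m = R-closed-neighbour x (proj₁ (proj₂ dropped))

      x-unique : ∀ {y} → R y ≡ m → N y ≡ false → y ≡ x
      x-unique {y} Ry≡m = proj₂ (proj₂ (proj₂ dropped)) y (R≡m⇒closed-neighbour y Ry≡m)

      stretch : Fin n → ℕ
      stretch i = if N i then suc m else R i

      L⁺ R⁺ colour⁺ : Fin (suc n) → ℕ
      L⁺ = snoc L (suc m)
      R⁺ = snoc stretch (suc m)
      colour⁺ = snoc colour (colour x)

      L-old : ∀ i → L⁺ (inject₁ i) ≡ L i
      L-old = snoc-inject₁ L (suc m)

      L-new : L⁺ (fromℕ n) ≡ suc m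
      L-new = snoc-fromℕ L (suc m)

      R-in : ∀ {i} → N i ≡ true → R⁺ (inject₁ i) ≡ suc m
      R-in {i} i∈N rewrite snoc-inject₁ stretch (suc m) i | i∈N = refl

      R-out : ∀ {i} → N i ≡ false → R⁺ (inject₁ i) ≡ R i
      R-out {i} i∉N rewrite snoc-inject₁ stretch (suc m) i | i∉N = refl

      R-new : R⁺ (fromℕ n) ≡ suc m
      R-new = snoc-fromℕ stretch (suc m)

      colour-old : ∀ i → colour⁺ (inject₁ i) ≡ colour i
      colour-old = snoc-inject₁ colour (colour x)

      colour-new : colour⁺ (fromℕ n) ≡ colour x
      colour-new = snoc-fromℕ colour (colour x)

      R≡m : ∀ {i} → N i ≡ true → R i ≡ m
      R≡m i∈N = R-closed-neighbour _ (N⇒closed-neighbour _ i∈N)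

      R≤R⁺ : ∀ i → R i ≤ R⁺ (inject₁ i)
      R≤R⁺ i with N i in Ni
      ... | true  rewrite R-in Ni  = ℕ.m≤n⇒m≤1+n (R≤m i)
      ... | false rewrite R-out Ni = ℕ.≤-refl

      meet-old : ∀ {a} i → a ≤ m → a ≤ R⁺ (inject₁ i) → a ≤ R i
      meet-old i a≤m a≤R⁺ with N i in Ni
      ... | true  rewrite R≡m Ni   = a≤m
      ... | false rewrite R-out Ni = a≤R⁺

      R⁺≤1+m : ∀ i → R⁺ i ≤ suc m
      R⁺≤1+m i with view i
      ... | ‵fromℕ = ℕ.≤-reflexive R-new
      ... | ‵inj₁ {i = i} _ with N i in Ni
      ...   | true  = ℕ.≤-reflexive (R-in Ni)
      ...   | false = subst (_≤ suc m) (sym (R-out Ni)) (ℕ.m≤n⇒m≤1+n (R≤m i))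

      L⁺≤R⁺ : ∀ i → L⁺ i ≤ R⁺ i
      L⁺≤R⁺ i with view i
      ... | ‵fromℕ = ℕ.≤-reflexive (trans L-new (sym R-new))
      ... | ‵inj₁ {i = i} _ = subst (_≤ _) (sym (L-old i)) (ℕ.≤-trans (L≤R i) (R≤R⁺ i))

      adj⇒meet⁺ : ∀ {i j} → adj G i j ≡ true → L⁺ i ≤ R⁺ j
      adj⇒meet⁺ {i} {j} ij with view i | view j
      ... | ‵fromℕ | ‵fromℕ = ℕ.≤-reflexive (trans L-new (sym R-new))
      ... | ‵fromℕ | ‵inj₁ _ = ℕ.≤-reflexive (trans L-new (sym (R-in ij)))
      ... | ‵inj₁ {i = i} _ | ‵fromℕ =
        subst₂ _≤_ (sym (L-old i)) (sym R-new) (ℕ.m≤n⇒m≤1+n (L≤m i))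
      ... | ‵inj₁ {i = i} _ | ‵inj₁ {i = j} _ =
        subst (_≤ _) (sym (L-old i)) (ℕ.≤-trans (adj⇒meet ij) (R≤R⁺ j))

      meet-new : ∀ i → L⁺ (fromℕ n) ≤ R⁺ (inject₁ i) → N i ≡ true
      meet-new i p with N i in Ni
      ... | true  = refl
      ... | false = contradiction (R≤m i) (ℕ.<⇒≱ (subst₂ _≤_ L-new (R-out Ni) p))

      meet⇒adj⁺ : ∀ {i j} → i ≢ j → L⁺ i ≤ R⁺ j → L⁺ j ≤ R⁺ i → adj G i j ≡ true
      meet⇒adj⁺ {i} {j} i≢j ij ji with view i | view j
      ... | ‵fromℕ | ‵fromℕ = contradiction refl i≢j
      ... | ‵fromℕ | ‵inj₁ {i = j} _ = meet-new j ij
      ... | ‵inj₁ {i = i} _ | ‵fromℕ = adj-sym G (meet-new i ji)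
      ... | ‵inj₁ {i = i} _ | ‵inj₁ {i = j} _ = meet⇒adj (i≢j ∘ cong inject₁)
        (meet-old j (L≤m i) (subst (_≤ _) (L-old i) ij))
        (meet-old i (L≤m j) (subst (_≤ _) (L-old j) ji))

      colour-x≢ : ∀ {i} → N i ≡ true → colour x ≢ colour i
      colour-x≢ {i} i∈N = colour-adj (meet⇒adj x≢i
        (subst (L x ≤_) (sym (R≡m i∈N)) (L≤m x)) (subst (L i ≤_) (sym Rx≡m) (L≤m i)))
        where
        x≢i : x ≢ i
        x≢i refl = contradiction (trans (sym x∉N) i∈N) λ ()

      colour-adj⁺ : ∀ {i j} → adj G i j ≡ true → colour⁺ i ≢ colour⁺ j
      colour-adj⁺ {i} {j} ij e with view i | view j
      ... | ‵fromℕ | ‵fromℕ = adj⇒≢ G ij refl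
      ... | ‵fromℕ | ‵inj₁ {i = j} _ =
        colour-x≢ ij (trans (sym colour-new) (trans e (colour-old j)))
      ... | ‵inj₁ {i = i} _ | ‵fromℕ =
        colour-x≢ (adj-sym G ij) (trans (sym colour-new) (trans (sym e) (colour-old i)))
      ... | ‵inj₁ {i = i} _ | ‵inj₁ {i = j} _ =
        colour-adj ij (trans (sym (colour-old i)) (trans e (colour-old j)))

      colour-next⁺ : ∀ {i j} → suc (R⁺ i) ≡ L⁺ j → colour⁺ i ≡ colour⁺ j
      colour-next⁺ {i} {j} e with view i
      ... | ‵fromℕ = contradiction (trans (cong suc (sym R-new)) e)
            (ℕ.>⇒≢ (s≤s (ℕ.≤-trans (L⁺≤R⁺ j) (R⁺≤1+m j))))
      ... | ‵inj₁ {i = i} _ with N i in Ni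
      ...   | true = contradiction (trans (cong suc (sym (R-in Ni))) e)
            (ℕ.>⇒≢ (s≤s (ℕ.≤-trans (L⁺≤R⁺ j) (R⁺≤1+m j))))
      ...   | false with view j
      -- After the stretching only `x` still ends at `m`, and the added vertex received its colour.
      ...     | ‵fromℕ = trans (colour-old i) (trans
                (cong colour (x-unique (ℕ.suc-injective (trans (cong suc (sym (R-out Ni))) (trans e L-new))) Ni))
                (sym colour-new))
      ...     | ‵inj₁ {i = j} _ = trans (colour-old i) (trans
                (colour-next (trans (cong suc (sym (R-out Ni))) (trans e (L-old j))))
                (sym (colour-old j)))

      ends⁺ : ∀ t → t ≤ suc m → ∃₂ λ r l → r ≢ l × R⁺ r ≡ t × L⁺ l ≡ t
      ends⁺ t t≤1+m with ℕ.m≤n⇒m<n∨m≡n t≤1+m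
      -- At `m + 1` the stretched `c` ends and the added vertex starts; at `m` the replaced `x` ends
      -- and `c` starts.
      ... | inj₂ refl = inject₁ c , fromℕ n , Fin.fromℕ≢inject₁ ∘ sym , R-in c∈N , L-new
      ... | inj₁ (s≤s t≤m) with ℕ.m≤n⇒m<n∨m≡n t≤m
      ...   | inj₂ refl = inject₁ x , inject₁ c , x≢c ∘ Fin.inject₁-injective ,
              trans (R-out x∉N) Rx≡m , trans (L-old c) Lc≡m
        where
        x≢c : x ≢ c
        x≢c e = contradiction (trans (sym x∉N) (trans (cong N e) c∈N)) λ ()
      ...   | inj₁ t<m = let r , l , r≢l , Rr≡t , Ll≡t = ends t t≤m in
              inject₁ r , inject₁ l , r≢l ∘ Fin.inject₁-injective ,
              trans (R-out (¬-not λ r∈N → ℕ.<⇒≢ t<m (trans (sym Rr≡t) (R≡m r∈N)))) Rr≡t ,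
              trans (L-old l) Ll≡t

      L-unique⁺ : ∀ {i j} → 0 < L⁺ i → L⁺ i ≡ L⁺ j → i ≡ j
      L-unique⁺ {i} {j} 0<L e with view i | view j
      ... | ‵fromℕ | ‵fromℕ = refl
      ... | ‵fromℕ | ‵inj₁ {i = j} _ = contradiction (L≤m j)
        (ℕ.<⇒≱ (ℕ.≤-reflexive (trans (sym L-new) (trans e (L-old j)))))
      ... | ‵inj₁ {i = i} _ | ‵fromℕ = contradiction (L≤m i)
        (ℕ.<⇒≱ (ℕ.≤-reflexive (trans (sym L-new) (trans (sym e) (L-old i)))))
      ... | ‵inj₁ {i = i} _ | ‵inj₁ {i = j} _ = cong inject₁ (L-unique
        (subst (0 <_) (L-old i) 0<L) (trans (sym (L-old i)) (trans e (L-old j))))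

      R⁺<1+m : ∀ i → R⁺ i < suc m → ∃ λ j → i ≡ inject₁ j × N j ≡ false × R⁺ i ≡ R j
      R⁺<1+m i R< with view i
      ... | ‵fromℕ = contradiction R-new (ℕ.<⇒≢ R<)
      ... | ‵inj₁ {i = j} _ with N j in Nj
      ...   | true  = contradiction (R-in Nj) (ℕ.<⇒≢ R<)
      ...   | false = j , refl , Nj , R-out Nj

      R-unique⁺ : ∀ {i j} → R⁺ i < suc m → R⁺ i ≡ R⁺ j → i ≡ j
      R-unique⁺ {i} {j} R< e with R⁺<1+m i R< | R⁺<1+m j (subst (_< suc m) e R<)
      ... | i′ , refl , i∉N , Ri | j′ , refl , j∉N , Rj = cong inject₁ (case ℕ.m≤n⇒m<n∨m≡n (R≤m i′) of λ where
        (inj₁ R<m) → R-unique R<m R≡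
        (inj₂ R≡m) → trans (x-unique R≡m i∉N) (sym (x-unique (trans (sym R≡) R≡m) j∉N)))
        where
        R≡ : R i′ ≡ R j′
        R≡ = trans (sym Ri) (trans e Rj)

    extended : IntervalModel k (suc m) G
    extended = record
      { L = L⁺
      ; R = R⁺
      ; colour = colour⁺
      ; size = cong suc size
      ; L≤R = L⁺≤R⁺
      ; R≤m = R⁺≤1+m
      ; adj⇒meet = adj⇒meet⁺
      ; meet⇒adj = meet⇒adj⁺
      ; colour-adj = colour-adj⁺
      ; colour-next = colour-next⁺
      ; ends = ends⁺
      ; L-unique = L-unique⁺
      ; R-unique = R-unique⁺
      }

  -- Building the interval model along the construction of the k-tree.

  AtMostTwoSimplicial : ∀ {n} → Graph n → Set
  AtMostTwoSimplicial G = ∀ {a b c} → a ≢ b → a ≢ c → b ≢ c →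
    Simplicial G a → Simplicial G b → Simplicial G c → ⊥

  module _ {k n : ℕ} (G : Graph (suc n)) (t : KTree k n (dropLast G))
           (clique : ∀ i j → AddedVertex.N G i ≡ true → AddedVertex.N G j ≡ true → i ≢ j →
                     adj (dropLast G) i j ≡ true) where

    open AddedVertex G

    -- Of three simplicial vertices of `H`, two lie on the same side of `N`. Two inside are
    -- adjacent, which forces `n = k + 1`; two outside stay simplicial in `G` and form a forbidden
    -- triple with the added vertex.
    at-most-two-simplicial-restrict : n ≢ suc k → AtMostTwoSimplicial G → AtMostTwoSimplicial H
    at-most-two-simplicial-restrict n≢1+k two {a} {b} {c} a≢b a≢c b≢c sa sb sc =
      go (N a) (N b) (N c) refl refl refl
      where
      both-inside : ∀ {i j} → i ≢ j → Simplicial H i → Simplicial H j → N i ≡ true → N j ≡ true → ⊥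
      both-inside i≢j si sj i∈N j∈N =
        n≢1+k (adjacent-simplicial⇒minimal t si sj (clique _ _ i∈N j∈N i≢j))

      both-outside : ∀ {i j} → i ≢ j → Simplicial H i → Simplicial H j → N i ≡ false → N j ≡ false → ⊥
      both-outside i≢j si sj i∉N j∉N = two (i≢j ∘ Fin.inject₁-injective)
        (Fin.fromℕ≢inject₁ ∘ sym) (Fin.fromℕ≢inject₁ ∘ sym)
        (simplicial-extend si i∉N) (simplicial-extend sj j∉N) (last-simplicial clique)

      go : ∀ p q r → N a ≡ p → N b ≡ q → N c ≡ r → ⊥
      go true  true  _     Na Nb Nc = both-inside a≢b sa sb Na Nb
      go true  false true  Na Nb Nc = both-inside a≢c sa sc Na Nc
      go true  false false Na Nb Nc = both-outside b≢c sb sc Nb Nc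
      go false true  true  Na Nb Nc = both-inside b≢c sb sc Nb Nc
      go false true  false Na Nb Nc = both-outside a≢c sa sc Na Nc
      go false false _     Na Nb Nc = both-outside a≢b sa sb Na Nb

    module _ (1≤k : 1 ≤ k) (|N|≡k : count N ≡ k) where

      -- The clique N must contain the simplicial vertex of one of the two ends of
      -- the model of H: otherwise both stay simplicial in G beside the new vertex.
      extend-model : ∀ {m} → AtMostTwoSimplicial G → IntervalModel k m H → IntervalModel k (suc m) G
      -- With a single clique every vertex has `L = 0 = m`, so any element of `N` can serve as `c`;
      -- one exists because `1 ≤ k`.
      extend-model {zero} _ M = Extension.extended G t |N|≡k clique M c c∈N (ℕ.n≤0⇒n≡0 (IntervalModel.L≤m M c))
        where
        witness = count-witness N (subst (1 ≤_) (sym |N|≡k) 1≤k)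
        c = proj₁ witness
        c∈N = proj₂ witness
      extend-model {suc m} two M
        with IntervalModel.ends M 0 z≤n | IntervalModel.ends M (suc m) ℕ.≤-refl
      ... | r , _ , _ , Rr≡0 , _ | _ , l , _ , _ , Ll≡m with N l in Nl | N r in Nr
      ...   | true  | _     = Extension.extended G t |N|≡k clique M l Nl Ll≡m
      ...   | false | true  = Extension.extended G t |N|≡k clique (reverse M) r Nr (cong (suc m ∸_) Rr≡0)
      ...   | false | false = ⊥-elim (two (r≢l ∘ Fin.inject₁-injective)
                (Fin.fromℕ≢inject₁ ∘ sym) (Fin.fromℕ≢inject₁ ∘ sym)
                (simplicial-extend (L≡m⇒simplicial (reverse M) (cong (suc m ∸_) Rr≡0)) Nr)
                (simplicial-extend (L≡m⇒simplicial M Ll≡m) Nl)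
                (last-simplicial clique))
        where
        r≢l : r ≢ l
        r≢l refl = contradiction (subst₂ _≤_ Ll≡m Rr≡0 (IntervalModel.L≤R M r)) λ ()

  ktree-model : ∀ {k n G} → 1 ≤ k → KTree k n G → AtMostTwoSimplicial G → ∃ λ m → IntervalModel k m G
  ktree-model 1≤k (base G complete) _ = 0 , complete-model 1≤k refl G complete
  ktree-model {k} 1≤k (step {n} G t |N|≡k clique) two with n ℕ.≟ suc k
  -- All vertices of a complete graph are simplicial, so the bound may fail for it and its model is
  -- given directly.
  ... | yes n≡1+k = 1 , extend-model G t clique 1≤k |N|≡k two
          (complete-model 1≤k n≡1+k (dropLast G) (minimal⇒complete t n≡1+k))
  ... | no  n≢1+k =
        let m , M = ktree-model 1≤k t (at-most-two-simplicial-restrict G t clique n≢1+k two)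
        in suc m , extend-model G t clique 1≤k |N|≡k two M
  ktree-model 1≤k (iso G H σ e t) two =
    let m , M = ktree-model 1≤k t (λ a≢b a≢c b≢c sa sb sc →
          two (a≢b ∘ injective) (a≢c ∘ injective) (b≢c ∘ injective)
            (simplicial-image sa) (simplicial-image sb) (simplicial-image sc))
    in m , transport G H σ e M
    where open Isomorphism G H σ e

  kpath-model : ∀ {k n G} → 1 ≤ k → KPath k n G → ∃ λ m → IntervalModel k m G
  kpath-model 1≤k (t , inj₁ (n≡1+k , complete)) = 0 , complete-model 1≤k n≡1+k _ complete
  kpath-model {k} {n} {G} 1≤k (t , inj₂ two) = ktree-model 1≤k t λ a≢b a≢c b≢c sa sb sc →
    contradiction (subst (3 ≤_) two (three≤count (λ i → degree G i ≡ᵇ k) a≢b a≢c b≢c (leaf sa) (leaf sb) (leaf sc)))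
      λ { (s≤s (s≤s ())) }
    where
    leaf : ∀ {i} → Simplicial G i → (degree G i ≡ᵇ k) ≡ true
    leaf s = dec-true (degree G _ ℕ.≟ k) (simplicial⇒degree t s)

open KPaths

-- Pivot edges for the cells.

module _ {k m n : ℕ} {G : Graph n} (M : IntervalModel k m G) where
  open IntervalModel M

  -- Supplies the pivot of cell `l`: an edge whose two ends occur in no later cell. If the cell has
  -- two cliques, take the vertices ending at `2l` and `2l + 1`; the latter did not start at
  -- `2l + 1`, where a different vertex enters, so the two meet at `2l`. If `2l = m`, take two
  -- vertices ending at `m`.
  same-cell-edge : ∀ l → l ≤ ⌊ m /2⌋ →
    ∃₂ λ u v → ⌊ R u /2⌋ ≡ l × ⌊ R v /2⌋ ≡ l × adj G u v ≡ true
  same-cell-edge l l≤m/2 with ℕ.m≤n⇒m<n∨m≡n 2l≤m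
    where
    2l≤m : l ℕ.+ l ≤ m
    2l≤m = ≡.subst (l ℕ.+ l ≤_) (ℕ.⌊n/2⌋+⌈n/2⌉≡n m)
      (ℕ.+-mono-≤ l≤m/2 (ℕ.≤-trans l≤m/2 (ℕ.⌊n/2⌋≤⌈n/2⌉ m)))
  ... | inj₁ 2l<m with ends (l ℕ.+ l) (ℕ.<⇒≤ 2l<m) | ends (suc (l ℕ.+ l)) 2l<m
  ...   | u , _ , _ , Ru , _ | v , w , v≢w , Rv , Lw = u , v ,
          ≡.trans (≡.cong ⌊_/2⌋ Ru) (≡.sym (ℕ.n≡⌊n+n/2⌋ l)) ,
          ≡.trans (≡.cong ⌊_/2⌋ Rv) (≡.sym (ℕ.n≡⌈n+n/2⌉ l)) ,
          meet⇒adj u≢v Lu≤Rv Lv≤Ru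
    where
    Ru<Rv : R u < R v
    Ru<Rv = ℕ.≤-reflexive (≡.trans (≡.cong suc Ru) (≡.sym Rv))
    u≢v : u ≢ v
    u≢v ≡.refl = ℕ.<-irrefl ≡.refl Ru<Rv
    Lu≤Rv : L u ≤ R v
    Lu≤Rv = ℕ.≤-trans (L≤R u) (ℕ.<⇒≤ Ru<Rv)
    Lv≢ : L v ≢ suc (l ℕ.+ l)
    Lv≢ Lv = v≢w (L-unique (≡.subst (0 <_) (≡.sym Lv) (s≤s z≤n)) (≡.trans Lv (≡.sym Lw)))
    Lv≤Ru : L v ≤ R u
    Lv≤Ru = ≡.subst (L v ≤_) (≡.sym Ru)
      (ℕ.≤-pred (ℕ.≤∧≢⇒< (≡.subst (L v ≤_) Rv (L≤R v)) Lv≢))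
  same-cell-edge l l≤m/2 | inj₂ 2l≡m with ends m ℕ.≤-refl
  ... | u , v , u≢v , Ru , Lv = u , v ,
          half Ru , half (ℕ.≤-antisym (R≤m v) (≡.subst (_≤ R v) Lv (L≤R v))) ,
          meet⇒adj u≢v (ℕ.≤-trans (L≤m u) (≡.subst (_≤ R v) Lv (L≤R v)))
            (≡.subst (L v ≤_) (≡.sym Ru) (L≤m v))
    where
    half : ∀ {r} → r ≡ m → ⌊ r /2⌋ ≡ l
    half r≡m = ≡.trans (≡.cong ⌊_/2⌋ (≡.trans r≡m (≡.sym 2l≡m))) (≡.sym (ℕ.n≡⌊n+n/2⌋ l))

-- Upper bound: a matrix with one rank 2 summand for each cell.

module Construction {c ℓ : Level} (F : Field c ℓ) (infinite : Infinite F)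
                    {k m n : ℕ} {G : Graph n} (M : IntervalModel k m G) where
  open Field F hiding (zero)
  open Matrices F
  open RingSolver commutativeRing
  open IntervalModel M
  open Relation.Binary.Reasoning.Setoid setoid

  private
    f : ℕ → Carrier
    f = proj₁ infinite

    f-≉ : ∀ {a b} → a ≢ b → ¬ f b - f a ≈ 0#
    f-≉ {a} {b} a≢b e = a≢b (≡.sym (proj₂ infinite b a (begin
      f b               ≈⟨ solve 2 (λ x y → x := (x :- y) :+ y) refl (f b) (f a) ⟩
      (f b - f a) + f a ≈⟨ +-congʳ e ⟩
      0# + f a          ≈⟨ +-identityˡ _ ⟩
      f a               ∎)))

  -- The telescoped sum of `f (l + 1) - f l` over `a ≤ l < b`, which is zero when the range is
  -- empty.
  δ : ℕ → ℕ → Carrier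
  δ a b with a ℕ.<? b
  ... | yes _ = f b - f a
  ... | no  _ = 0#

  private
    δ-< : ∀ {a b} → a < b → δ a b ≈ f b - f a
    δ-< {a} {b} a<b with a ℕ.<? b
    ... | yes _   = refl
    ... | no  a≮b = contradiction a<b a≮b

    δ-≥ : ∀ {a b} → b ≤ a → δ a b ≈ 0#
    δ-≥ {a} {b} b≤a with a ℕ.<? b
    ... | yes a<b = contradiction b≤a (ℕ.<⇒≱ a<b)
    ... | no  _   = refl

    δ-inside : ∀ {a l b} → a ≤ l → l ≤ b → δ (a ℕ.⊔ l) (suc b) ≈ (f (suc l) - f l) + δ (a ℕ.⊔ suc l) (suc b)
    δ-inside {a} {l} {b} a≤l l≤b rewrite ℕ.m≤n⇒m⊔n≡n a≤l | ℕ.m≤n⇒m⊔n≡n (ℕ.m≤n⇒m≤1+n a≤l)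
      with ℕ.m≤n⇒m<n∨m≡n l≤b
    ... | inj₁ l<b = begin
      δ l (suc b)                                    ≈⟨ δ-< (s≤s l≤b) ⟩
      f (suc b) - f l                                ≈⟨ solve 3 (λ x y z → x :- z := (y :- z) :+ (x :- y)) refl _ _ _ ⟩
      (f (suc l) - f l) + (f (suc b) - f (suc l))    ≈⟨ +-congˡ (δ-< (s≤s l<b)) ⟨
      (f (suc l) - f l) + δ (suc l) (suc b)          ∎
    ... | inj₂ ≡.refl = begin
      δ l (suc l)                                    ≈⟨ δ-< ℕ.≤-refl ⟩
      f (suc l) - f l                                ≈⟨ +-identityʳ _ ⟨
      (f (suc l) - f l) + 0#                         ≈⟨ +-congˡ (δ-≥ {suc l} ℕ.≤-refl) ⟨
      (f (suc l) - f l) + δ (suc l) (suc l)          ∎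

    δ-outside : ∀ {a l b} → ¬ (a ≤ l × l ≤ b) → δ (a ℕ.⊔ l) (suc b) ≈ δ (a ℕ.⊔ suc l) (suc b)
    δ-outside {a} {l} {b} outside with a ℕ.≤? l
    ... | no  a≰l rewrite ℕ.m≥n⇒m⊔n≡m (ℕ.<⇒≤ (ℕ.≰⇒> a≰l)) | ℕ.m≥n⇒m⊔n≡m (ℕ.≰⇒> a≰l) = refl
    ... | yes a≤l = trans (δ-≥ (ℕ.≤-trans b<l (ℕ.m≤n⊔m a l)))
                     (sym (δ-≥ (ℕ.≤-trans b<l (ℕ.≤-trans (ℕ.n≤1+n l) (ℕ.m≤n⊔m a (suc l))))))
      where
      b<l : b < l
      b<l = ℕ.≰⇒> λ l≤b → outside (a≤l , l≤b)

    κ : Fin n → Carrier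
    κ = f ∘ colour

    first last : Fin n → ℕ
    first x = ⌊ L x /2⌋
    last x = ⌊ R x /2⌋

    first≤last : ∀ x → first x ≤ last x
    first≤last x = ℕ.⌊n/2⌋-mono (L≤R x)

  -- The contribution of the cells numbered l or higher; cell l consists of the cliques
  -- Q (2l) and Q (2l + 1).
  weight : ℕ → Matrix F n
  weight l x y = δ (first x ℕ.⊔ first y ℕ.⊔ l) (suc (last x ℕ.⊓ last y))

  matrix : ℕ → Matrix F n
  matrix l x y = (κ y - κ x) * weight l x y

  private
    InCell : ℕ → Fin n → Set
    InCell l x = first x ≤ l × l ≤ last x

    inCell? : ∀ l x → Dec (InCell l x)
    inCell? l x = (first x ℕ.≤? l) ×-dec (l ℕ.≤? last x)

    χ : ℕ → Fin n → Carrier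
    χ l x with inCell? l x
    ... | yes _ = 1#
    ... | no  _ = 0#

    χ-in : ∀ {l x} → InCell l x → χ l x ≈ 1#
    χ-in {l} {x} p with inCell? l x
    ... | yes _ = refl
    ... | no ¬p = contradiction p ¬p

    step-weight : ℕ → Carrier
    step-weight l = f (suc l) - f l

    -- The cells from `l` on that contain both `x` and `y` are consecutive, so removing cell `l`
    -- either drops the first term of the telescoping sum or changes nothing.
    weight-step : ∀ l x y → weight l x y ≈ χ l x * χ l y * step-weight l + weight (suc l) x y
    weight-step l x y with inCell? l x | inCell? l y
    ... | yes (fx , lx) | yes (fy , ly) = trans
          (δ-inside (ℕ.⊔-lub fx fy) (ℕ.⊓-glb lx ly))
          (+-congʳ (sym (trans (*-congʳ (*-identityˡ 1#)) (*-identityˡ _))))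
    ... | yes _ | no ¬y = trans
          (δ-outside λ (p , q) → ¬y (ℕ.m⊔n≤o⇒n≤o (first x) _ p , ℕ.m≤n⊓o⇒m≤o (last x) _ q))
          (sym (trans (+-congʳ (trans (*-congʳ (zeroʳ _)) (zeroˡ _))) (+-identityˡ _)))
    ... | no ¬x | _ = trans
          (δ-outside λ (p , q) → ¬x (ℕ.m⊔n≤o⇒m≤o (first x) _ p , ℕ.m≤n⊓o⇒m≤n (last x) _ q))
          (sym (trans (+-congʳ (trans (*-congʳ (zeroˡ _)) (zeroˡ _))) (+-identityˡ _)))

    weight-sym : ∀ l x y → weight l y x ≡ weight l x y
    weight-sym l x y = ≡.cong₂ δ (≡.cong (ℕ._⊔ l) (ℕ.⊔-comm (first y) (first x)))
                                 (≡.cong suc (ℕ.⊓-comm (last y) (last x)))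

    matrix-skew : ∀ l x y → matrix l y x ≈ - matrix l x y
    matrix-skew l x y = begin
      (κ x - κ y) * weight l y x    ≡⟨ ≡.cong ((κ x - κ y) *_) (weight-sym l x y) ⟩
      (κ x - κ y) * weight l x y    ≈⟨ solve 3 (λ p q w → (p :- q) :* w := :- ((q :- p) :* w)) refl _ _ _ ⟩
      - ((κ y - κ x) * weight l x y) ∎

    matrix-diagonal : ∀ l x → matrix l x x ≈ 0#
    matrix-diagonal l x = trans (*-congʳ (-‿inverseʳ _)) (zeroˡ _)

    module Pivot {l : ℕ} {u v : Fin n} (lu : last u ≡ l) (lv : last v ≡ l) (uv : adj G u v ≡ true) where
      s = step-weight l

      in-cell : ∀ {u} → last u ≡ l → InCell l u
      in-cell {u} e = ≡.subst (first u ≤_) e (first≤last u) , ℕ.≤-reflexive (≡.sym e)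

      -- Cell `l` is the last one containing `u`, so no later cell contributes to this column.
      column : ∀ {u} → last u ≡ l → ∀ x → matrix l x u ≈ (κ u - κ x) * (χ l x * s)
      column {u} e x = *-congˡ (begin
        weight l x u                                ≈⟨ weight-step l x u ⟩
        χ l x * χ l u * s + weight (suc l) x u      ≈⟨ +-cong (*-congʳ (*-congˡ (χ-in (in-cell e)))) (δ-≥ (ℕ.≤-trans
                                                        (s≤s (≡.subst (last x ℕ.⊓ last u ≤_) e (ℕ.m⊓n≤n (last x) (last u))))
                                                        (ℕ.m≤n⊔m (first x ℕ.⊔ first u) (suc l)))) ⟩
        χ l x * 1# * s + 0#                         ≈⟨ trans (+-identityʳ _) (*-congʳ (*-identityʳ _)) ⟩
        χ l x * s                                   ∎)

      row : ∀ {u} → last u ≡ l → ∀ y → matrix l u y ≈ (κ y - κ u) * (χ l y * s)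
      row {u} e y = begin
        matrix l u y                        ≈⟨ matrix-skew l y u ⟩
        - matrix l y u                      ≈⟨ -‿cong (column e y) ⟩
        - ((κ u - κ y) * (χ l y * s))       ≈⟨ solve 3 (λ p q w → :- ((p :- q) :* w) := (q :- p) :* w) refl _ _ _ ⟩
        (κ y - κ u) * (χ l y * s)           ∎

      a = (κ v - κ u) * s

      a≉0 : ¬ a ≈ 0#
      a≉0 = ¬0-* (f-≉ (colour-adj uv)) (f-≉ (ℕ.<⇒≢ ℕ.≤-refl))

      b = proj₁ (inverse a a≉0)

      ab≈1 : matrix l u v * b ≈ 1#
      ab≈1 = trans (*-congʳ (trans (column lv u) (*-congˡ (trans (*-congʳ (χ-in (in-cell lu))) (*-identityˡ s)))))
                   (proj₂ (inverse a a≉0))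

      -- The identity behind this is the Plücker relation
      -- (κv - κx)(κy - κu) - (κu - κx)(κy - κv) = (κv - κu)(κy - κx).
      schur-step : ∀ x y → matrix (suc l) x y ≈ schur (matrix l) u v b x y
      schur-step x y = sym (begin
        (matrix l x y + - (b * matrix l x v) * matrix l u y) + (b * matrix l x u) * matrix l v y
          ≈⟨ +-cong (+-cong (*-congˡ (weight-step l x y))
               (*-cong (-‿cong (*-congˡ (column lv x))) (row lu y)))
               (*-cong (*-congˡ (column lu x)) (row lv y)) ⟩
        ((κ y - κ x) * (χx * χy * s + w)
          + - (b * ((κ v - κ x) * (χx * s))) * ((κ y - κ u) * (χy * s)))
          + (b * ((κ u - κ x) * (χx * s))) * ((κ y - κ v) * (χy * s))
          ≈⟨ solve 9 (λ x y u v p q s w b →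
               ((y :- x) :* (p :* q :* s :+ w)
                 :+ :- (b :* ((v :- x) :* (p :* s))) :* ((y :- u) :* (q :* s)))
                 :+ (b :* ((u :- x) :* (p :* s))) :* ((y :- v) :* (q :* s))
               := ((y :- x) :* w :+ (y :- x) :* (p :* q :* s))
                 :- ((v :- u) :* s :* b) :* ((y :- x) :* (p :* q :* s))) refl
               (κ x) (κ y) (κ u) (κ v) χx χy s w b ⟩
        (κ y - κ x) * w + z - (a * b) * z
          ≈⟨ +-congˡ (-‿cong (trans (*-congʳ (proj₂ (inverse a a≉0))) (*-identityˡ z))) ⟩
        (κ y - κ x) * w + z - z
          ≈⟨ solve 2 (λ t z → t :+ z :- z := t) refl _ z ⟩
        (κ y - κ x) * w  ∎)
        where
        χx = χ l x
        χy = χ l y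
        w = weight (suc l) x y
        z = (κ y - κ x) * (χx * χy * s)

  -- One pivot for each of the `d` cells from `l` on; past cell `⌊ m /2⌋` every weight is an empty
  -- sum.
  reduces : ∀ d l → l ℕ.+ d ≡ suc ⌊ m /2⌋ → Reduces (matrix l) d
  reduces zero l e = vanishing λ x y → trans (*-congˡ (δ-≥ (ℕ.≤-trans
      (≡.subst (suc (last x ℕ.⊓ last y) ≤_) (≡.trans (≡.sym e) (ℕ.+-identityʳ l))
        (s≤s (ℕ.≤-trans (ℕ.m⊓n≤m (last x) _) (ℕ.⌊n/2⌋-mono (R≤m x)))))
      (ℕ.m≤n⊔m (first x ℕ.⊔ first y) l)))) (zeroʳ _)
  reduces (suc d) l e with same-cell-edge M l l≤m/2
    where
    l≤m/2 : l ≤ ⌊ m /2⌋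
    l≤m/2 = ℕ.m+n≤o⇒m≤o l (ℕ.≤-reflexive (ℕ.suc-injective (≡.trans (≡.sym (ℕ.+-suc l d)) e)))
  ... | u , v , lu , lv , uv =
    pivot u v b ab≈1 (matrix-diagonal l u) (matrix-diagonal l v) (matrix-skew l u v) schur-step
      (reduces d (suc l) (≡.trans (≡.sym (ℕ.+-suc l d)) e))
    where open Pivot lu lv uv

  rank : HasRank F (matrix 0) (suc ⌊ m /2⌋ ℕ.* 2)
  rank = reduces⇒rank (reduces _ 0 ≡.refl)

  private
    -- If `j` starts immediately after `i` ends, their colours agree and the first factor vanishes.
    -- A larger gap separates their cells, as each cell has at most two cliques, and the weight
    -- vanishes.
    far⇒zero : ∀ {i j} → R i < L j → matrix 0 i j ≈ 0#
    far⇒zero {i} {j} Ri<Lj with ℕ.m≤n⇒m<n∨m≡n Ri<Lj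
    ... | inj₂ next = trans (*-congʳ (trans (+-congʳ (reflexive (≡.cong f (≡.sym (colour-next next))))) (-‿inverseʳ _))) (zeroˡ _)
    ... | inj₁ gap = trans (*-congˡ (δ-≥ (ℕ.≤-trans (s≤s (ℕ.m⊓n≤m (last i) (last j)))
            (ℕ.≤-trans (ℕ.⌊n/2⌋-mono gap) (ℕ.≤-trans (ℕ.m≤n⊔m (first i) (first j)) (ℕ.m≤m⊔n _ 0)))))) (zeroʳ _)

    nonadjacent⇒zero : ∀ {i j} → i ≢ j → adj G i j ≡ false → matrix 0 i j ≈ 0#
    nonadjacent⇒zero {i} {j} i≢j ij∉G with L i ℕ.≤? R j | L j ℕ.≤? R i
    ... | _         | no Lj≰Ri  = far⇒zero (ℕ.≰⇒> Lj≰Ri)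
    ... | no Li≰Rj  | yes _     = begin
      matrix 0 i j      ≈⟨ matrix-skew 0 j i ⟩
      - matrix 0 j i    ≈⟨ -‿cong (far⇒zero (ℕ.≰⇒> Li≰Rj)) ⟩
      - 0#              ≈⟨ solve 0 (:- #0 := #0) refl ⟩
      0#                ∎
    ... | yes Li≤Rj | yes Lj≤Ri = contradiction (≡.trans (≡.sym ij∉G) (meet⇒adj i≢j Li≤Rj Lj≤Ri)) λ ()

    adjacent⇒nonzero : ∀ {i j} → adj G i j ≡ true → ¬ matrix 0 i j ≈ 0#
    adjacent⇒nonzero {i} {j} ij = ¬0-* (f-≉ (colour-adj ij))
      λ w≈0 → f-≉ (ℕ.<⇒≢ start<stop) (trans (sym (δ-< start<stop)) w≈0)
      where
      -- Adjacent vertices share a clique, hence a cell, so the range of the telescoping sum is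
      -- nonempty.
      start<stop : first i ℕ.⊔ first j ℕ.⊔ 0 < suc (last i ℕ.⊓ last j)
      start<stop = s≤s (ℕ.⊔-lub (ℕ.⊔-lub
        (ℕ.⊓-glb (first≤last i) (ℕ.⌊n/2⌋-mono (adj⇒meet ij)))
        (ℕ.⊓-glb (ℕ.⌊n/2⌋-mono (adj⇒meet (adj-sym G ij))) (first≤last j))) z≤n)

  matrix∈S⁻ : InSminus F G (matrix 0)
  matrix∈S⁻ = matrix-skew 0 , λ i j i≢j → nonzero⇒adjacent i≢j , adjacent⇒nonzero
    where
    nonzero⇒adjacent : ∀ {i j} → i ≢ j → ¬ matrix 0 i j ≈ 0# → adj G i j ≡ true
    nonzero⇒adjacent {i} {j} i≢j A≉0 with adj G i j in ij
    ... | true  = ≡.refl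
    ... | false = contradiction (nonadjacent⇒zero i≢j ij) A≉0

-- Lower bound: a triangular submatrix and parity of the rank.

module LowerBound {c ℓ : Level} (F : Field c ℓ) {k m n : ℕ} {G : Graph n} (M : IntervalModel k m G)
                  {A : Matrix F n} (inS : InSminus F G A) {s : ℕ} (rankA : HasRank F A s) where
  open Field F hiding (zero)
  open Matrices F
  open IntervalModel M

  private
    end : (t : Fin (suc m)) → ∃₂ λ r l → r ≢ l × R r ≡ toℕ t × L l ≡ toℕ t
    end t = ends (toℕ t) (Fin.toℕ≤pred[n] t)

    row col : Fin (suc m) → Fin n
    row t = proj₁ (end t)
    col t = proj₁ (proj₂ (end t))

    row≢col : ∀ t → row t ≢ col t
    row≢col t = proj₁ (proj₂ (proj₂ (end t)))

    R-row : ∀ t → R (row t) ≡ toℕ t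
    R-row t = proj₁ (proj₂ (proj₂ (proj₂ (end t))))

    L-col : ∀ t → L (col t) ≡ toℕ t
    L-col t = proj₂ (proj₂ (proj₂ (proj₂ (end t))))

    T : Fin (suc m) → Fin (suc m) → Carrier
    T t u = A (row t) (col u)

    T-diagonal : ∀ t → ¬ T t t ≈ 0#
    T-diagonal t = proj₂ (proj₂ inS _ _ (row≢col t)) (meet⇒adj (row≢col t)
      (ℕ.≤-trans (L≤R _) (≡.subst (_≤ R (col t)) (≡.trans (L-col t) (≡.sym (R-row t))) (L≤R _)))
      (ℕ.≤-reflexive (≡.trans (L-col t) (≡.sym (R-row t)))))

    -- The vertex of row `t` ends before that of column `u` starts, so the two are nonadjacent.
    -- `InSminus` says only that nonzero entries are edges, hence the double negation.
    T-upper : ∀ {t u} → t Fin.< u → ¬ ¬ T t u ≈ 0#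
    T-upper {t} {u} t<u T≉0 = ℕ.<⇒≱ R<L
      (adj⇒meet (adj-sym G (proj₁ (proj₂ inS _ _ row≢col′) T≉0)))
      where
      R<L : R (row t) < L (col u)
      R<L = ≡.subst₂ _<_ (≡.sym (R-row t)) (≡.sym (L-col u)) t<u
      row≢col′ : row t ≢ col u
      row≢col′ e = ℕ.<⇒≱ R<L (≡.subst (λ x → L x ≤ R (row t)) e (L≤R (row t)))

    T-upper-all : ¬ ¬ (∀ t u → t Fin.< u → T t u ≈ 0#)
    T-upper-all = ∀-¬¬ λ t → ∀-¬¬ λ u k → case t Fin.<? u of λ where
      (yes t<u) → T-upper t<u λ T≈0 → k λ _ → T≈0
      (no t≮u)  → k λ t<u → contradiction t<u t≮u

  1+m≤rank : suc m ≤ s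
  1+m≤rank = ℕ.≮⇒≥ λ s<1+m → T-upper-all λ upper → ℕ.<⇒≱ s<1+m
    -- A relation among the chosen columns, read in the chosen rows alone, is a kernel vector of
    -- `T`.
    (proj₂ rankA (suc m) col λ w Aw≈0 →
      triangular-kernel T T-diagonal (upper _ _) w (Aw≈0 ∘ row))

  -- A smaller rank would be exactly `m + 1`, which is odd.
  2+m≤rank : CharNot2 F → suc m % 2 ≡ 1 → suc (suc m) ≤ s
  2+m≤rank 2≉0 odd = ℕ.≮⇒≥ λ s<2+m →
    alternating-rank-even (skew⇒alternating 2≉0 (proj₁ inS)) rankA λ (p , s≡2p) →
      contradiction (≡.trans (≡.sym odd) (≡.trans
        (≡.cong (_% 2) (≡.trans (ℕ.≤-antisym 1+m≤rank (ℕ.≤-pred s<2+m)) s≡2p)) (m*n%n≡0 p 2))) λ ()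

-- Parity of `m + 1 = n - k` and the final assembly.

even-half : ∀ m → suc m % 2 ≡ 0 → suc ⌊ m /2⌋ ℕ.* 2 ≡ suc m
even-half (suc zero)    _ = ≡.refl
even-half (suc (suc m)) e = ≡.cong (2 ℕ.+_) (even-half m e)

odd-half : ∀ m → suc m % 2 ≡ 1 → suc ⌊ m /2⌋ ℕ.* 2 ≡ suc (suc m)
odd-half zero          _ = ≡.refl
odd-half (suc (suc m)) e = ≡.cong (2 ℕ.+_) (odd-half m e)

theorem3p2 : {c ℓ : Level} (F : Field c ℓ) → Infinite F → CharNot2 F →
    (k n : ℕ) → 1 ≤ k → (G : Graph n) → KPath k n G →
    ((n ∸ k) % 2 ≡ 0 → MinSkewRank F G (n ∸ k)) ×
    ((n ∸ k) % 2 ≡ 1 → MinSkewRank F G (suc (n ∸ k)))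
theorem3p2 F infinite 2≉0 k n 1≤k G path with kpath-model 1≤k path
-- The size of the model turns `n ∸ k` into `suc m` throughout the goal.
... | m , M rewrite ≡.trans (≡.cong (_∸ k) (IntervalModel.size M)) (ℕ.m+n∸n≡m (suc m) k) =
  (λ even → (matrix 0 , matrix∈S⁻ , ≡.subst (HasRank F (matrix 0)) (even-half m even) rank) ,
            λ A s inS rankA → LowerBound.1+m≤rank F M inS rankA) ,
  (λ odd → (matrix 0 , matrix∈S⁻ , ≡.subst (HasRank F (matrix 0)) (odd-half m odd) rank) ,
           λ A s inS rankA → LowerBound.2+m≤rank F M inS rankA 2≉0 odd)
  where open Construction F infinite M
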